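{- For every integer $n\ge1$, the map $\Phi_{\mathrm B}:\mathcal{PT}_{\mathrm B}(n)\to B_n$ is a bijection.
   Context: Shifted Ferrers diagrams: a Ferrers diagram $F$ of length $n$ (rows plus columns, empty rows and columns allowed) has its south-east border steps labeled $1,\dots,n$ from north-east to south-west; a row gets the label of its south step, a column the label of its west step. So $F$ amounts to a splitting of $\{1,\dots,n\}$ into row labels and column labels; rows go top to bottom in increasing label order, columns left to right in decreasing label order, and there is a cell in Row $r$, Column $c$ iff $r<c$. If $F$ has $k$ columns, the shifted Ferrers diagram $\overline F$ is obtained by adding $k$ left-justified rows of sizes $1,2,\dots,k$ (top to bottom) above $F$; its length is that of $F$. The rightmost cells of the added rows are the diagonal cells. The added row whose diagonal cell is in Column $j$ is labeled $-j$; thus Row $-j$ has a cell in Column $c$ iff $c\ge j$ ($c$ a column label), and rows are again ordered top to bottom by increasing label. Type B permutation tableaux: $\mathcal{PT}_{\mathrm B}(n)$ is the set of shifted Ferrers diagrams of length $n$ with a $0,1$-filling such that (1) each column has at least one $1$; (2) there is no $0$ having both a $1$ above it in the same column and a $1$ to the left of it in the same row; (3) if a diagonal cell contains $0$, there is no $1$ to the left of it in the same row. A $0$ is restricted if it has a $1$ above it in the same column or it is in a diagonal cell. A row is unrestricted if it contains no restricted $0$. Alternative representation of $T\in\mathcal{PT}_{\mathrm B}(n)$: replace each topmost $1$ (topmost $1$ of its column) by $\uparrow$ and each rightmost restricted $0$ (rightmost restricted $0$ of its row) by $\leftarrow$, erase all other entries, and then discard the diagonal cells together with any arrows in them. So arrows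 remain only in non-diagonal cells, each column has at most one $\uparrow$, and Column $c$ has no $\uparrow$ exactly when the diagonal cell of Column $c$ contains a $1$. $B_n$ is the set of type B permutations of $\{1,\dots,n\}$: words obtained from a permutation of $\{1,\dots,n\}$ (in one-line notation) by negating any subset of its entries. The map $\Phi_{\mathrm B}$: let $T\in\mathcal{PT}_{\mathrm B}(n)$ (in alternative representation) have columns labeled $c_1<\cdots<c_k$. Let $\pi^{(k+1)}$ be the word of the labels of the unrestricted rows of $T$ in increasing order. For $i=k,k-1,\dots,1$, obtain $\pi^{(i)}$ from $\pi^{(i+1)}$ as follows. If Column $c_i$ has a $\uparrow$, in Row $r_0$ say, insert $c_i$ immediately before $r_0$; if Column $c_i$ has no $\uparrow$, do nothing (in this case $-c_i$ is already in the word). Then, if $r_1<\cdots<r_s$ are the labels of the rows containing a $\leftarrow$ in Column $c_i$, insert $r_1,\dots,r_s$ in this order immediately before $c_i$ (if Column $c_i$ has a $\uparrow$) or immediately before $-c_i$ (if not). Set $\Phi_{\mathrm B}(T)=\pi^{(1)}$. -}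

module Defs where

open import Data.Fin using (Fin; toℕ; _<_; _≤_)
import Data.Fin.Properties as Fin
open import Data.Fin.Patterns using (0F; 1F)
open import Data.Fin.Subset using (Subset; _∈_; _∉_)
open import Data.Fin.Subset.Properties using (_∈?_)
open import Data.Integer as ℤ using (ℤ; +_; -[1+_])
import Data.Integer.Properties as ℤ
open import Data.List using (List; []; _∷_; [_]; _++_; map; reverse; filter; foldr; allFin)
open import Data.List.Relation.Binary.Permutation.Propositional using (_↭_)
open import Data.Maybe as Maybe using (Maybe; just; nothing; _>>=_)
open import Data.Nat as ℕ using (ℕ; suc)
open import Data.Product using (∃; ∃-syntax; _×_; _,_)
open import Data.Sum using (_⊎_; inj₁; inj₂)
open import Level using (0ℓ)
open import Relation.Binary.Bundles using (Setoid)
open import Relation.Binary.PropositionalEquality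
  using (_≡_; refl; sym; trans; cong; subst)
open import Relation.Nullary using (¬_; Dec; yes; no)
open import Relation.Nullary.Decidable using (map′; ¬?; _×-dec_; _⊎-dec_)
open import Relation.Unary using (Pred; Decidable)

-- The index i : Fin n stands for the label 1 + toℕ i, so pos i and neg i
-- stand for the integers 1 + toℕ i and -(1 + toℕ i).

data Letter (n : ℕ) : Set where
  pos neg : Fin n → Letter n

module _ {n : ℕ} where

  ⟦_⟧ : Letter n → ℤ
  ⟦ pos i ⟧ = + suc (toℕ i)
  ⟦ neg i ⟧ = -[1+ toℕ i ]

  abs : Letter n → Fin n
  abs (pos i) = i
  abs (neg i) = i

  _≺_ : Letter n → Letter n → Set
  x ≺ y = ⟦ x ⟧ ℤ.< ⟦ y ⟧

  _≺?_ : ∀ x y → Dec (x ≺ y)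
  x ≺? y = ⟦ x ⟧ ℤ.<? ⟦ y ⟧

  _≟_ : (x y : Letter n) → Dec (x ≡ y)
  pos i ≟ pos j = map′ (cong pos) (λ { refl → refl }) (i Fin.≟ j)
  pos i ≟ neg j = no λ ()
  neg i ≟ pos j = no λ ()
  neg i ≟ neg j = map′ (cong neg) (λ { refl → refl }) (i Fin.≟ j)

  any? : {P : Pred (Letter n) 0ℓ} → Decidable P → Dec (∃ P)
  any? P? = map′ (λ { (inj₁ (i , p)) → pos i , p ; (inj₂ (i , p)) → neg i , p })
                 (λ { (pos i , p) → inj₁ (i , p) ; (neg i , p) → inj₂ (i , p) })
                 (Fin.any? (λ i → P? (pos i)) ⊎-dec Fin.any? (λ i → P? (neg i)))

-- In increasing order: -n, …, -1, 1, …, n.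
letters : ∀ n → List (Letter n)
letters n = map neg (reverse (allFin n)) ++ map pos (allFin n)

------------------------------------------------------------------------
-- Shifted Ferrers diagrams and fillings

-- A diagram F of length n is given by the set C of its column labels; the
-- labels outside C are its row labels.  The rows of the shifted diagram are
-- the rows of F and one added row, labelled -j, for each column j.

module _ {n : ℕ} (C : Subset n) where

  IsRow : Letter n → Set
  IsRow (pos i) = i ∉ C
  IsRow (neg j) = j ∈ C

  Reaches : Letter n → Fin n → Set
  Reaches (pos i) c = i < c
  Reaches (neg j) c = j ≤ c

  Cell : Letter n → Fin n → Set
  Cell r c = IsRow r × c ∈ C × Reaches r c

  isRow? : Decidable IsRow
  isRow? (pos i) = ¬? (i ∈? C)
  isRow? (neg j) = j ∈? C

  reaches? : ∀ r c → Dec (Reaches r c)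
  reaches? (pos i) c = i Fin.<? c
  reaches? (neg j) c = j Fin.≤? c

  cell? : ∀ r c → Dec (Cell r c)
  cell? r c = isRow? r ×-dec (c ∈? C) ×-dec reaches? r c

-- The values of entry outside the cells carry no meaning: nothing below
-- depends on them, and _≈_ ignores them.
record Filling (n : ℕ) : Set where
  field
    columns : Subset n
    entry   : Letter n → Fin n → Fin 2

-- Row r' is above Row r iff r' ≺ r, and Column c' is to the left of
-- Column c iff c < c'.

module _ {n : ℕ} (T : Filling n) where
  open Filling T

  One Zero OneAbove OneLeft Restricted : Letter n → Fin n → Set
  One        r c = Cell columns r c × entry r c ≡ 1F
  Zero       r c = Cell columns r c × entry r c ≡ 0F
  OneAbove   r c = ∃[ r′ ] r′ ≺ r × One r′ c
  OneLeft    r c = ∃[ c′ ] c < c′ × One r c′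
  Restricted r c = Zero r c × (OneAbove r c ⊎ r ≡ neg c)

  UnrestrictedRow : Letter n → Set
  UnrestrictedRow r = IsRow columns r × ¬ (∃[ c ] Restricted r c)

  -- The arrows of the alternative representation; those in the diagonal
  -- cells (neg c , c) are discarded only after the topmost 1s and the
  -- rightmost restricted 0s have been determined.
  UpArrow LeftArrow : Letter n → Fin n → Set
  UpArrow   r c = (One r c × ¬ OneAbove r c) × ¬ r ≡ neg c
  LeftArrow r c = (Restricted r c × ¬ (∃[ c′ ] c′ < c × Restricted r c′)) × ¬ r ≡ neg c

  one? : ∀ r c → Dec (One r c)
  one? r c = cell? columns r c ×-dec (entry r c Fin.≟ 1F)

  oneAbove? : ∀ r c → Dec (OneAbove r c)
  oneAbove? r c = any? λ r′ → (r′ ≺? r) ×-dec one? r′ c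

  restricted? : ∀ r c → Dec (Restricted r c)
  restricted? r c = (cell? columns r c ×-dec (entry r c Fin.≟ 0F))
                    ×-dec (oneAbove? r c ⊎-dec (r ≟ neg c))

  unrestrictedRow? : Decidable UnrestrictedRow
  unrestrictedRow? r = isRow? columns r ×-dec ¬? (Fin.any? (restricted? r))

  upArrow? : ∀ r c → Dec (UpArrow r c)
  upArrow? r c = (one? r c ×-dec ¬? (oneAbove? r c)) ×-dec ¬? (r ≟ neg c)

  leftArrow? : ∀ r c → Dec (LeftArrow r c)
  leftArrow? r c =
    (restricted? r c ×-dec ¬? (Fin.any? λ c′ → (c′ Fin.<? c) ×-dec restricted? r c′))
    ×-dec ¬? (r ≟ neg c)

record PT (n : ℕ) : Set where
  field
    filling : Filling n
  open Filling filling public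
  field
    column-has-one : ∀ c → c ∈ columns → ∃[ r ] One filling r c
    zero-condition : ∀ r c → Zero filling r c →
                     ¬ (OneAbove filling r c × OneLeft filling r c)
    diag-condition : ∀ c → Zero filling (neg c) c → ¬ OneLeft filling (neg c) c

module _ {n : ℕ} where
  open PT

  _≈_ : PT n → PT n → Set
  T ≈ U = columns T ≡ columns U ×
          (∀ r c → Cell (columns T) r c → entry T r c ≡ entry U r c)

PT-setoid : ℕ → Setoid 0ℓ 0ℓ
PT-setoid n = record
  { Carrier       = PT n
  ; _≈_           = _≈_
  ; isEquivalence = record
    { refl  = refl , λ _ _ _ → refl
    ; sym   = λ (p , e) → sym p ,
                λ r c x → sym (e r c (subst (λ C → Cell C r c) (sym p) x))
    ; trans = λ (p , e) (q , f) → trans p q ,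
                λ r c x → trans (e r c x) (f r c (subst (λ C → Cell C r c) p x))
    }
  }

------------------------------------------------------------------------
-- Type B permutations

record B (n : ℕ) : Set where
  field
    word   : List (Letter n)
    isPerm : map abs word ↭ allFin n

B-setoid : ℕ → Setoid 0ℓ 0ℓ
B-setoid n = record
  { Carrier       = B n
  ; _≈_           = λ σ τ → B.word σ ≡ B.word τ
  ; isEquivalence = record { refl = refl ; sym = sym ; trans = trans }
  }

------------------------------------------------------------------------
-- The map Φ

module _ {n : ℕ} where

  -- insertBefore x us w inserts the word us immediately before the first
  -- letter x of w, and fails if x does not occur in w.
  insertBefore : Letter n → List (Letter n) → List (Letter n) → Maybe (List (Letter n))
  insertBefore x us []      = nothing
  insertBefore x us (y ∷ w) with x ≟ y
  ... | yes _ = just (us ++ y ∷ w)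
  ... | no  _ = Maybe.map (y ∷_) (insertBefore x us w)

  -- Column c, from π⁽ⁱ⁺¹⁾ to π⁽ⁱ⁾.
  step : Filling n → Fin n → List (Letter n) → Maybe (List (Letter n))
  step T c w with any? (λ r → upArrow? T r c)
  ... | yes (r₀ , _) = insertBefore r₀ [ pos c ] w >>=
                       insertBefore (pos c) (filter (λ r → leftArrow? T r c) (letters n))
  ... | no _         = insertBefore (neg c) (filter (λ r → leftArrow? T r c) (letters n)) w

  -- The fold treats the columns in decreasing order of their labels.  The
  -- value is nothing if the letter before which to insert is ever missing;
  -- that Φ is well defined includes that this never happens.
  Φ : PT n → Maybe (List (Letter n))
  Φ T = foldr (λ c w → w >>= step filling c)
              (just (filter (unrestrictedRow? filling) (letters n)))
              (filter (_∈? columns) (allFin n))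
    where open PT T

{-# OPTIONS --safe #-}

-- Treat every label c in decreasing order, a row label doing nothing, and let
-- w k be the word when the labels above k have been treated.  In w k two
-- adjacent letters of absolute value at most k always increase.  This makes
-- each step reversible: the smallest label c treated so far is a row iff it
-- occurs as c and the next letter, if any, has larger absolute value; otherwise
-- the letters inserted with Column c form the longest run, immediately before
-- c or -c, of letters of absolute value < c that exceed the letter r₀ after c
-- (or r₀ = -c itself).  Conversely the tableau can be read off the words:
-- the cell (r, c) contains 1 iff Row r is not above the topmost 1 of Column c,
-- which is in Row r₀, and r occurs in the word to which Column c is applied.

module Submission where

open import Defs
open import Data.Bool using (true; if_then_else_)
open import Data.Empty using (⊥; ⊥-elim)
open import Data.Fin using (Fin; toℕ)
open import Data.Fin.Patterns using (0F; 1F)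
import Data.Fin.Properties as Fin
open import Data.Fin.Subset using (Subset) renaming (_∈_ to _∈ₛ_; _∉_ to _∉ₛ_)
import Data.Fin.Subset.Properties as Subset
open Subset using (_∈?_)
import Data.Integer as ℤ
import Data.Integer.Properties as ℤ
open import Data.List using (List; []; _∷_; [_]; _++_; _∷ʳ_; map; filter; foldr; reverse; tabulate; allFin; initLast; _∷ʳ′_)
import Data.List.Properties as List
open import Data.List.Membership.Propositional using (_∈_; _∉_)
import Data.List.Membership.DecPropositional as DecMembership
import Data.List.Membership.Propositional.Properties as Mem
open import Data.List.Membership.Propositional.Properties.WithK using (unique∧set⇒bag)
open import Data.List.Relation.Binary.BagAndSetEquality using (∼bag⇒↭)
open import Data.List.Relation.Binary.Permutation.Propositional using (_↭_; ↭-sym; ↭-trans; ↭⇒↭ₛ)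
open import Data.List.Relation.Binary.Permutation.Propositional.Properties using (shifts; ++⁺ˡ; ∈-resp-↭)
import Data.List.Relation.Binary.Permutation.Setoid.Properties as Permutationₛ
open import Data.List.Relation.Unary.All as All using (All; []; _∷_)
import Data.List.Relation.Unary.All.Properties as All
open import Data.List.Relation.Unary.AllPairs as AllPairs using (AllPairs; []; _∷_)
import Data.List.Relation.Unary.AllPairs.Properties as AllPairs
open import Data.List.Relation.Unary.Any using (here; there)
import Data.List.Relation.Unary.Any.Properties as Any
open import Data.List.Relation.Unary.Linked as Linked using (Linked; []; [-]; _∷_)
import Data.List.Relation.Unary.Linked.Properties as Linked
open import Data.List.Relation.Unary.Unique.Propositional using (Unique)
import Data.List.Relation.Unary.Unique.Propositional.Properties as Unique
open import Data.Maybe using (Maybe; just; nothing; is-just; _>>=_)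
open import Data.Maybe.Properties using (just-injective)
open import Data.Nat as ℕ using (ℕ; zero; suc; _<_; _≤_; _≥_; s≤s; z≤n)
import Data.Nat.Properties as ℕ
open import Data.Product using (∃; ∃₂; ∃-syntax; Σ-syntax; _×_; _,_; proj₁; proj₂; map₂)
open import Data.Sum as Sum using (_⊎_; inj₁; inj₂)
import Data.Vec as Vec
import Data.Vec.Properties as Vec
open import Function using (_∘_; flip; case_of_; mk⇔)
open import Function.Bundles using (Bijection)
open import Level using (0ℓ)
open import Relation.Binary.Core using (Rel)
open import Relation.Binary.Definitions using (tri<; tri≈; tri>)
open import Relation.Binary.PropositionalEquality using (_≡_; _≢_; refl; sym; trans; cong; subst; subst₂; setoid; module ≡-Reasoning)
open import Relation.Nullary using (¬_; Dec; yes; no; contradiction)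
open import Relation.Nullary.Decidable using (_×-dec_; does)
open import Relation.Unary using (Pred; Decidable)

-- Lists

module _ {A : Set} where

  unique-resp-↭ : ∀ {xs ys : List A} → xs ↭ ys → Unique xs → Unique ys
  unique-resp-↭ p = Permutationₛ.Unique-resp-↭ (setoid A) (↭⇒↭ₛ p)

  unique-++⁻ʳ : ∀ (xs : List A) {ys} → Unique (xs ++ ys) → Unique ys
  unique-++⁻ʳ []       u       = u
  unique-++⁻ʳ (x ∷ xs) (_ ∷ u) = unique-++⁻ʳ xs u

  unique-∉ˡ : ∀ (xs : List A) {a ys} → Unique (xs ++ a ∷ ys) → a ∉ xs
  unique-∉ˡ (x ∷ xs) (x∉ ∷ _) (here refl) = All.lookup x∉ (Mem.∈-insert xs) refl
  unique-∉ˡ (x ∷ xs) (_ ∷ u)  (there a∈)  = unique-∉ˡ xs u a∈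

  unique-∉ʳ : ∀ (xs : List A) {a ys} → Unique (xs ++ a ∷ ys) → a ∉ ys
  unique-∉ʳ xs u a∈ = Unique.Unique[x∷xs]⇒x∉xs (unique-++⁻ʳ xs u) a∈

  unique-disjoint : ∀ (xs : List A) {ys a} → Unique (xs ++ ys) → a ∈ xs → a ∉ ys
  unique-disjoint (x ∷ xs) (x∉ ∷ _) (here refl) a∈ = All.lookup x∉ (Mem.∈-++⁺ʳ xs a∈) refl
  unique-disjoint (x ∷ xs) (_ ∷ u)  (there a∈xs) a∈ = unique-disjoint xs u a∈xs a∈

  split-unique : ∀ (xs xs′ : List A) {a ys ys′} → a ∉ xs → a ∉ xs′ →
                 xs ++ a ∷ ys ≡ xs′ ++ a ∷ ys′ → xs ≡ xs′ × ys ≡ ys′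
  split-unique []       []         _  _   refl = refl , refl
  split-unique []       (x′ ∷ xs′) _  a∉′ refl = contradiction (here refl) a∉′
  split-unique (x ∷ xs) []         a∉ _   refl = contradiction (here refl) a∉
  split-unique (x ∷ xs) (x′ ∷ xs′) a∉ a∉′ eq   with List.∷-injective eq
  ... | refl , eq′ with split-unique xs xs′ (a∉ ∘ there) (a∉′ ∘ there) eq′
  ...   | refl , refl = refl , refl

  module _ {P : Pred A 0ℓ} where

    EndsOutside : List A → Set
    EndsOutside xs = ∀ {ys y} → xs ≡ ys ∷ʳ y → ¬ P y

    endsOutside-tail : ∀ {x xs} → EndsOutside (x ∷ xs) → EndsOutside xs
    endsOutside-tail {x} e {ys} eq = e {x ∷ ys} (cong (x ∷_) eq)

    endsOutside-suffix : ∀ xs {rs} → EndsOutside xs → All P (xs ++ rs) → xs ≡ []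
    endsOutside-suffix xs end ps with initLast xs
    ... | []       = refl
    ... | ys ∷ʳ′ y = contradiction (All.head (All.++⁻ʳ ys (All.++⁻ˡ (ys ∷ʳ y) ps))) (end refl)

    maximalSuffix-unique : ∀ xs xs′ {rs rs′} → EndsOutside xs → EndsOutside xs′ →
                           All P rs → All P rs′ → xs ++ rs ≡ xs′ ++ rs′ → xs ≡ xs′ × rs ≡ rs′
    maximalSuffix-unique []       xs′        _ e′ p p′ refl with endsOutside-suffix xs′ e′ p
    ... | refl = refl , refl
    maximalSuffix-unique (x ∷ xs) []         e _  p p′ refl = case endsOutside-suffix (x ∷ xs) e p′ of λ ()
    maximalSuffix-unique (x ∷ xs) (x′ ∷ xs′) e e′ p p′ eq   with List.∷-injective eq
    ... | refl , eq′ with maximalSuffix-unique xs xs′ (endsOutside-tail e) (endsOutside-tail e′) p p′ eq′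
    ...   | refl , refl = refl , refl

    maximalSuffix : Decidable P → ∀ zs → ∃₂ λ xs rs → zs ≡ xs ++ rs × EndsOutside xs × All P rs
    maximalSuffix P? [] = [] , [] , refl , (λ { {[]} () ; {_ ∷ _} () }) , []
    maximalSuffix P? (z ∷ zs) with maximalSuffix P? zs
    ... | y ∷ xs , rs , refl , e , ps =
      z ∷ y ∷ xs , rs , refl , (λ { {[]} () ; {_ ∷ _} eq → e (List.∷-injectiveʳ eq) }) , ps
    ... | [] , rs , refl , e , ps with P? z
    ...   | yes p = [] , z ∷ rs , refl , (λ { {[]} () ; {_ ∷ _} () }) , p ∷ ps
    ...   | no ¬p = [ z ] , rs , refl , (λ { {[]} refl → ¬p ; {_ ∷ []} () ; {_ ∷ _ ∷ _} () }) , ps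

  module _ {R : Rel A 0ℓ} where

    linked-++⁺ : ∀ {xs z zs} → Linked R xs → (∀ {ys y} → xs ≡ ys ∷ʳ y → R y z) →
                 Linked R (z ∷ zs) → Linked R (xs ++ z ∷ zs)
    linked-++⁺ []      h l = l
    linked-++⁺ [-]     h l = h {[]} refl ∷ l
    linked-++⁺ {x ∷ _} (p ∷ q) h l = p ∷ linked-++⁺ q (λ {ys} eq → h {x ∷ ys} (cong (x ∷_) eq)) l

    linked-++⁻ʳ : ∀ xs {ys} → Linked R (xs ++ ys) → Linked R ys
    linked-++⁻ʳ []       l = l
    linked-++⁻ʳ (x ∷ xs) l = linked-++⁻ʳ xs (Linked.tail l)

    linked-++⁻ˡ : ∀ xs {ys} → Linked R (xs ++ ys) → Linked R xs
    linked-++⁻ˡ []           l       = []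
    linked-++⁻ˡ (x ∷ [])     l       = [-]
    linked-++⁻ˡ (x ∷ y ∷ xs) (p ∷ l) = p ∷ linked-++⁻ˡ (y ∷ xs) l

    linked-refine : ∀ {P : Pred A 0ℓ} {S : Rel A 0ℓ} {xs} → (∀ {x y} → P x → P y → R x y → S x y) →
                    All P xs → Linked R xs → Linked S xs
    linked-refine f _            []      = []
    linked-refine f _            [-]     = [-]
    linked-refine f (p ∷ q ∷ ps) (r ∷ l) = f p q r ∷ linked-refine f (q ∷ ps) l

    linked-last : ∀ xs {ys y z zs} → Linked R (xs ++ z ∷ zs) → xs ≡ ys ∷ʳ y → R y z
    linked-last _ {ys} {y} {z} {zs} l refl =
      Linked.head (linked-++⁻ʳ ys (subst (Linked R) (List.++-assoc ys [ y ] (z ∷ zs)) l))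

    allPairs-reverse : ∀ {xs} → AllPairs R xs → AllPairs (flip R) (reverse xs)
    allPairs-reverse [] = []
    allPairs-reverse {x ∷ xs} (p ∷ ps) rewrite List.unfold-reverse x xs =
      AllPairs.++⁺ (allPairs-reverse ps) ([] ∷ [])
        (All.tabulate λ y∈ → All.lookup p (Any.reverse⁻ y∈) ∷ [])

-- Letters

module _ {n : ℕ} where

  ∣_∣ : Letter n → ℕ
  ∣ x ∣ = toℕ (abs x)

  ≺-trans : ∀ {x y z : Letter n} → x ≺ y → y ≺ z → x ≺ z
  ≺-trans = ℤ.<-trans

  ≺-irrefl : ∀ {x : Letter n} → ¬ x ≺ x
  ≺-irrefl = ℤ.<-irrefl refl

  ≺-asym : ∀ {x y : Letter n} → x ≺ y → ¬ y ≺ x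
  ≺-asym = ℤ.<-asym

  ⟦⟧-injective : ∀ {x y : Letter n} → ⟦ x ⟧ ≡ ⟦ y ⟧ → x ≡ y
  ⟦⟧-injective {pos i} {pos j} eq = cong pos (Fin.toℕ-injective (ℤ.+[1+-injective eq))
  ⟦⟧-injective {neg i} {neg j} eq = cong neg (Fin.toℕ-injective (ℤ.-[1+-injective eq))

  ≺-connex : ∀ {x y : Letter n} → x ≢ y → ¬ x ≺ y → y ≺ x
  ≺-connex {x} {y} x≢y x⊀y with ℤ.<-cmp ⟦ x ⟧ ⟦ y ⟧
  ... | tri< a _ _ = contradiction a x⊀y
  ... | tri≈ _ b _ = contradiction (⟦⟧-injective b) x≢y
  ... | tri> _ _ c = c

  ≺-antisym : ∀ {x y : Letter n} → ¬ x ≺ y → ¬ y ≺ x → x ≡ y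
  ≺-antisym {x} {y} x⊀y y⊀x with x ≟ y
  ... | yes p = p
  ... | no  q = contradiction (≺-connex q x⊀y) y⊀x

  ⊀-≺-trans : ∀ {x y z : Letter n} → ¬ x ≺ y → x ≺ z → y ≺ z
  ⊀-≺-trans {x} {y} x⊀y x≺z with x ≟ y
  ... | yes refl = x≺z
  ... | no x≢y   = ≺-trans (≺-connex x≢y x⊀y) x≺z

  neg≺ : ∀ {x : Letter n} {c} → ∣ x ∣ < toℕ c → neg c ≺ x
  neg≺ {pos _} _ = ℤ.-<+
  neg≺ {neg _} p = ℤ.-<- p

  ≺pos : ∀ {x : Letter n} {c} → ∣ x ∣ < toℕ c → x ≺ pos c
  ≺pos {pos _} p = ℤ.+<+ (s≤s p)
  ≺pos {neg _} _ = ℤ.-<+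

  Sorted : List (Letter n) → Set
  Sorted = AllPairs _≺_

  sorted⇒unique : ∀ {xs} → Sorted xs → Unique xs
  sorted⇒unique = AllPairs.map λ { p refl → ≺-irrefl p }

  sorted-ext : ∀ {xs ys} → Sorted xs → Sorted ys →
               (∀ {x} → x ∈ xs → x ∈ ys) → (∀ {x} → x ∈ ys → x ∈ xs) → xs ≡ ys
  sorted-ext [] [] _ _ = refl
  sorted-ext [] (_ ∷ _) _ g = case g (here refl) of λ ()
  sorted-ext (_ ∷ _) [] f _ = case f (here refl) of λ ()
  sorted-ext {x ∷ xs} {y ∷ ys} (p ∷ ps) (q ∷ qs) f g with x≡y
    where
    x≡y : x ≡ y
    x≡y with f (here refl) | g (here refl)
    ... | here eq  | _        = eq
    ... | there _  | here eq  = sym eq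
    ... | there x∈ | there y∈ = contradiction (All.lookup p y∈) (≺-asym (All.lookup q x∈))
  ... | refl = cong (x ∷_) (sorted-ext ps qs (strip p f) (strip q g))
    where
    strip : ∀ {us vs} → All (x ≺_) us → (∀ {z} → z ∈ x ∷ us → z ∈ x ∷ vs) → ∀ {z} → z ∈ us → z ∈ vs
    strip p h z∈ with h (there z∈)
    ... | here refl = contradiction (All.lookup p z∈) ≺-irrefl
    ... | there z∈′ = z∈′

  ∈-letters : ∀ (x : Letter n) → x ∈ letters n
  ∈-letters (pos i) = Mem.∈-++⁺ʳ _ (Mem.∈-map⁺ pos (Mem.∈-allFin i))
  ∈-letters (neg i) = Mem.∈-++⁺ˡ (Mem.∈-map⁺ neg (Any.reverse⁺ (Mem.∈-allFin i)))

  letters-sorted : Sorted (letters n)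
  letters-sorted = AllPairs.++⁺
    (AllPairs.map⁺ (AllPairs.map ℤ.-<- (allPairs-reverse (AllPairs.tabulate⁺-< λ p → p))))
    (AllPairs.map⁺ (AllPairs.map (λ p → ℤ.+<+ (s≤s p)) (AllPairs.tabulate⁺-< λ p → p)))
    (All.map⁺ (All.tabulate λ _ → All.map⁺ (All.tabulate λ _ → ℤ.-<+)))

  select : {P : Pred (Letter n) 0ℓ} → Decidable P → List (Letter n)
  select P? = filter P? (letters n)

  module _ {P : Pred (Letter n) 0ℓ} (P? : Decidable P) where

    select-sorted : Sorted (select P?)
    select-sorted = AllPairs.filter⁺ P? letters-sorted

    ∈-select⁺ : ∀ {x} → P x → x ∈ select P?
    ∈-select⁺ = Mem.∈-filter⁺ P? (∈-letters _)

    ∈-select⁻ : ∀ {x} → x ∈ select P? → P x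
    ∈-select⁻ = proj₂ ∘ Mem.∈-filter⁻ P? {xs = letters n}

    select-unique : ∀ {xs} → Sorted xs → (∀ {x} → P x → x ∈ xs) → (∀ {x} → x ∈ xs → P x) →
                    select P? ≡ xs
    select-unique s f g = sorted-ext select-sorted s (f ∘ ∈-select⁻) (∈-select⁺ ∘ g)

    minimum : ∃ P → ∃[ x ] P x × (∀ {y} → P y → ¬ y ≺ x)
    minimum (y , p) with select P? in eq
    ... | [] = case subst (_ ∈_) eq (∈-select⁺ p) of λ ()
    ... | x ∷ xs = x , ∈-select⁻ (subst (_ ∈_) (sym eq) (here refl)) , least
      where
      least : ∀ {y} → P y → ¬ y ≺ x
      least q y≺x with subst (_ ∈_) eq (∈-select⁺ q) | subst Sorted eq select-sorted
      ... | here refl | _     = ≺-irrefl y≺x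
      ... | there y∈  | s ∷ _ = ≺-asym y≺x (All.lookup s y∈)

-- Moves and their reversal

module _ {n : ℕ} where

  -- The index k counts labels: pos i and neg i have absolute value at most k
  -- in the sense of the paper iff toℕ i < k.
  Rises : ℕ → Rel (Letter n) 0ℓ
  Rises k x y = ∣ x ∣ < k → ∣ y ∣ < k → x ≺ y

  record State (k : ℕ) (w : List (Letter n)) : Set where
    field
      unique   : Unique w
      abs-inj  : ∀ {x y} → x ∈ w → y ∈ w → abs x ≡ abs y → x ≡ y
      rising   : Linked (Rises k) w
      complete : ∀ i → k ≤ toℕ i → ∃[ x ] x ∈ w × abs x ≡ i

  data Mark (c : Fin n) : List (Letter n) → Letter n → Set where
    diagonal : Mark c [] (neg c)
    arrow    : ∀ {r} → ∣ r ∣ < toℕ c → Mark c [ pos c ] r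

  Fits : Fin n → Letter n → Pred (Letter n) 0ℓ
  Fits c r x = ∣ x ∣ < toℕ c × r ≺ x

  -- The first index is the row of the topmost 1 of Column c, and nothing if c
  -- labels a row.
  data Move (c : Fin n) : Maybe (Letter n) → Rel (List (Letter n)) 0ℓ where
    skip   : ∀ {w} → pos c ∈ w → Move c nothing w w
    insert : ∀ {r u v w} xs rs ys → Mark c u r → Sorted rs → All (Fits c r) rs →
             v ≡ xs ++ r ∷ ys → w ≡ xs ++ rs ++ u ++ r ∷ ys → Move c (just r) v w

  mark-≤ : ∀ {c u r} → Mark c u r → ∣ r ∣ ≤ toℕ c
  mark-≤ diagonal  = ℕ.≤-refl
  mark-≤ (arrow p) = ℕ.<⇒≤ p

  mark-head : ∀ {c u r} ys → Mark c u r → ∃₂ λ h ts → u ++ r ∷ ys ≡ h ∷ ts × abs h ≡ c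
  mark-head ys diagonal  = _ , _ , refl , refl
  mark-head ys (arrow _) = _ , _ , refl , refl

  rising⇒endsOutside : ∀ {c r} xs {ys} → ∣ r ∣ ≤ toℕ c →
                       Linked (Rises (suc (toℕ c))) (xs ++ r ∷ ys) → EndsOutside {P = Fits c r} xs
  rising⇒endsOutside xs r≤c l eq (y<c , r≺y) =
    ≺-asym r≺y (linked-last xs l eq (ℕ.m<n⇒m<1+n y<c) (s≤s r≤c))

  module _ {c : Fin n} {w : List (Letter n)} (S : State (toℕ c) w) where
    open State

    ¬pos∈×neg∈ : pos c ∈ w → neg c ∈ w → ⊥
    ¬pos∈×neg∈ p∈ n∈ = case abs-inj S p∈ n∈ refl of λ ()

    ¬skip×insert : ∀ {r v} → State (suc (toℕ c)) w → Move c nothing w w → Move c (just r) v w → ⊥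
    ¬skip×insert S⁺ (skip p∈) (insert xs rs ys diagonal _ _ _ refl) =
      ¬pos∈×neg∈ p∈ (Mem.∈-++⁺ʳ xs (Mem.∈-insert rs))
    ¬skip×insert S⁺ (skip p∈) (insert xs rs ys (arrow r<c) _ _ _ refl) =
      ≺-asym (≺pos r<c)
        (Linked.head (linked-++⁻ʳ rs (linked-++⁻ʳ xs (rising S⁺))) ℕ.≤-refl (ℕ.m<n⇒m<1+n r<c))

    blocks-unique : ∀ {a} xs rs {ys} xs′ rs′ {ys′} →
                    w ≡ xs ++ rs ++ a ∷ ys → w ≡ xs′ ++ rs′ ++ a ∷ ys′ →
                    xs ++ rs ≡ xs′ ++ rs′ × ys ≡ ys′
    blocks-unique {a} xs rs {ys} xs′ rs′ {ys′} eq eq′ =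
      split-unique (xs ++ rs) (xs′ ++ rs′)
        (unique-∉ˡ (xs ++ rs) (subst Unique eq₁ (unique S)))
        (unique-∉ˡ (xs′ ++ rs′) (subst Unique eq₁′ (unique S)))
        (trans (sym eq₁) eq₁′)
      where
      eq₁ : w ≡ (xs ++ rs) ++ a ∷ ys
      eq₁ = trans eq (sym (List.++-assoc xs rs (a ∷ ys)))
      eq₁′ : w ≡ (xs′ ++ rs′) ++ a ∷ ys′
      eq₁′ = trans eq′ (sym (List.++-assoc xs′ rs′ (a ∷ ys′)))

    move-deterministic : ∀ {d d′ v v′} → State (suc (toℕ c)) v → State (suc (toℕ c)) v′ →
                         Move c d v w → Move c d′ v′ w → d ≡ d′ × v ≡ v′
    move-deterministic V V′ (skip _) (skip _) = refl , refl
    move-deterministic V V′ m@(skip _) m′@(insert _ _ _ _ _ _ _ _) = ⊥-elim (¬skip×insert V m m′)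
    move-deterministic V V′ m@(insert _ _ _ _ _ _ _ _) m′@(skip _) = ⊥-elim (¬skip×insert V′ m′ m)
    move-deterministic V V′ (insert xs rs ys diagonal _ fs refl eq) (insert xs′ rs′ ys′ diagonal _ fs′ refl eq′)
      with blocks-unique xs rs xs′ rs′ eq eq′
    ... | xs≡ , refl
      with maximalSuffix-unique xs xs′ (rising⇒endsOutside xs ℕ.≤-refl (rising V))
             (rising⇒endsOutside xs′ ℕ.≤-refl (rising V′)) fs fs′ xs≡
    ... | refl , refl = refl , refl
    move-deterministic V V′ (insert xs rs ys (arrow r<c) _ fs refl eq) (insert xs′ rs′ ys′ (arrow r<c′) _ fs′ refl eq′)
      with blocks-unique xs rs xs′ rs′ eq eq′
    ... | xs≡ , refl
      with maximalSuffix-unique xs xs′ (rising⇒endsOutside xs (ℕ.<⇒≤ r<c) (rising V))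
             (rising⇒endsOutside xs′ (ℕ.<⇒≤ r<c′) (rising V′)) fs fs′ xs≡
    ... | refl , refl = refl , refl
    move-deterministic V V′ (insert xs rs _ diagonal _ _ _ eq) (insert xs′ rs′ _ (arrow _) _ _ _ eq′) =
      ⊥-elim (¬pos∈×neg∈ (subst (pos c ∈_) (sym eq′) (Mem.∈-++⁺ʳ xs′ (Mem.∈-insert rs′)))
                         (subst (neg c ∈_) (sym eq) (Mem.∈-++⁺ʳ xs (Mem.∈-insert rs))))
    move-deterministic V V′ (insert xs rs _ (arrow _) _ _ _ eq) (insert xs′ rs′ _ diagonal _ _ _ eq′) =
      ⊥-elim (¬pos∈×neg∈ (subst (pos c ∈_) (sym eq) (Mem.∈-++⁺ʳ xs (Mem.∈-insert rs)))
                         (subst (neg c ∈_) (sym eq′) (Mem.∈-++⁺ʳ xs′ (Mem.∈-insert rs′))))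

  insertion-↭ : ∀ (xs rs u vs : List (Letter n)) → xs ++ rs ++ u ++ vs ↭ rs ++ u ++ xs ++ vs
  insertion-↭ xs rs u vs = ↭-trans (shifts xs rs) (++⁺ˡ rs (shifts xs u))

  module _ (xs rs u vs : List (Letter n)) {x : Letter n} where

    ∈-insertion⁻ : x ∈ xs ++ rs ++ u ++ vs → x ∈ rs ⊎ x ∈ u ⊎ x ∈ xs ++ vs
    ∈-insertion⁻ x∈ = Sum.map₂ (Mem.∈-++⁻ u) (Mem.∈-++⁻ rs (∈-resp-↭ (insertion-↭ xs rs u vs) x∈))

    ∈-insertion⁺ : x ∈ rs ⊎ x ∈ u ⊎ x ∈ xs ++ vs → x ∈ xs ++ rs ++ u ++ vs
    ∈-insertion⁺ x∈ = ∈-resp-↭ (↭-sym (insertion-↭ xs rs u vs))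
      (Sum.[ Mem.∈-++⁺ˡ , Mem.∈-++⁺ʳ rs ∘ Sum.[ Mem.∈-++⁺ˡ , Mem.∈-++⁺ʳ u ] ] x∈)

  rises-weaken : ∀ {k x y} → Rises (suc k) x y → Rises k x y
  rises-weaken p x<k y<k = p (ℕ.m<n⇒m<1+n x<k) (ℕ.m<n⇒m<1+n y<k)

  rises-vacuousʳ : ∀ {c x y} → abs y ≡ c → Rises (toℕ c) x y
  rises-vacuousʳ refl _ y<c = contradiction y<c (ℕ.<-irrefl refl)

  rises-vacuousˡ : ∀ {c x y} → abs x ≡ c → Rises (toℕ c) x y
  rises-vacuousˡ refl x<c = contradiction x<c (ℕ.<-irrefl refl)

  insert-rising : ∀ {c u r} xs rs ys → Mark c u r → Sorted rs → All (Fits c r) rs →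
                  Linked (Rises (suc (toℕ c))) (xs ++ r ∷ ys) →
                  Linked (Rises (toℕ c)) (xs ++ rs ++ u ++ r ∷ ys)
  insert-rising {c} {u} {r} xs rs ys m s fs l with mark-head ys m
  ... | h , ts , eq , h≡c = subst (λ us → Linked _ (xs ++ rs ++ us)) (sym eq) (front rs fs block)
    where
    l′ : Linked (Rises (toℕ c)) (xs ++ r ∷ ys)
    l′ = Linked.map rises-weaken l

    marked : ∀ {u} → Mark c u r → Linked (Rises (toℕ c)) (u ++ r ∷ ys)
    marked diagonal  = linked-++⁻ʳ xs l′
    marked (arrow _) = rises-vacuousˡ refl ∷ linked-++⁻ʳ xs l′

    block : Linked (Rises (toℕ c)) (rs ++ h ∷ ts)
    block = linked-++⁺ (Linked.map (λ p _ _ → p) (Linked.AllPairs⇒Linked s))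
              (λ _ → rises-vacuousʳ h≡c) (subst (Linked _) eq (marked m))

    front : ∀ rs → All (Fits c r) rs → Linked (Rises (toℕ c)) (rs ++ h ∷ ts) →
            Linked (Rises (toℕ c)) (xs ++ rs ++ h ∷ ts)
    front []       _              b = linked-++⁺ (linked-++⁻ˡ xs l′) (λ _ → rises-vacuousʳ h≡c) b
    front (x ∷ rs) ((_ , r≺x) ∷ _) b = linked-++⁺ (linked-++⁻ˡ xs l′)
      (λ eq y<c _ → ≺-trans (linked-last xs l eq (ℕ.m<n⇒m<1+n y<c) (s≤s (mark-≤ m))) r≺x) b

  fits? : ∀ c r → Decidable (Fits c r)
  fits? c r x = (∣ x ∣ ℕ.<? toℕ c) ×-dec (r ≺? x)

  below : ∀ {c : Fin n} (x : Letter n) → abs x ≢ c → ∣ x ∣ < suc (toℕ c) → ∣ x ∣ < toℕ c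
  below _ x≢c (s≤s x≤c) = ℕ.≤∧≢⇒< x≤c (x≢c ∘ Fin.toℕ-injective)

  rising-suc : ∀ {c xs} → All (λ x → abs x ≢ c) xs → Linked (Rises (toℕ c)) xs →
               Linked (Rises (suc (toℕ c))) xs
  rising-suc = linked-refine λ {x} {y} x≢c y≢c p x<c y<c → p (below x x≢c x<c) (below y y≢c y<c)

  module _ {c : Fin n} {w : List (Letter n)} (S : State (toℕ c) w) where
    open State S

    abs-≢ : ∀ zs {h ts} → w ≡ zs ++ h ∷ ts → abs h ≡ c →
            All (λ x → abs x ≢ c) zs × All (λ x → abs x ≢ c) ts
    abs-≢ zs {h} {ts} refl h≡c =
      All.tabulate (λ x∈ eq → unique-∉ˡ zs unique (subst (_∈ zs) (same (Mem.∈-++⁺ˡ x∈) eq) x∈)) ,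
      All.tabulate (λ x∈ eq → unique-∉ʳ zs unique (subst (_∈ ts) (same (Mem.∈-++⁺ʳ zs (there x∈)) eq) x∈))
      where
      same : ∀ {x} → x ∈ w → abs x ≡ c → x ≡ h
      same x∈ eq = abs-inj x∈ (Mem.∈-insert zs) (trans eq (sym h≡c))

    skip-state : ∀ zs {ts} → w ≡ zs ++ pos c ∷ ts → (∀ {r ys} → ts ≡ r ∷ ys → ¬ ∣ r ∣ < toℕ c) →
                 State (suc (toℕ c)) w
    skip-state zs {ts} refl h = record
      { unique   = unique
      ; abs-inj  = abs-inj
      ; rising   = linked-++⁺ (rising-suc zs≢ (linked-++⁻ˡ zs rising))
                     (λ { {us} {y} refl y<c _ → ≺pos (below y (All.head (All.++⁻ʳ us zs≢)) y<c) })
                     (tail ts≢ h (linked-++⁻ʳ zs rising))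
      ; complete = λ i c<i → complete i (ℕ.<⇒≤ c<i)
      }
      where
      zs≢ = proj₁ (abs-≢ zs refl refl)
      ts≢ = proj₂ (abs-≢ zs refl refl)

      tail : ∀ {ts} → All (λ x → abs x ≢ c) ts → (∀ {r ys} → ts ≡ r ∷ ys → ¬ ∣ r ∣ < toℕ c) →
             Linked (Rises (toℕ c)) (pos c ∷ ts) → Linked (Rises (suc (toℕ c))) (pos c ∷ ts)
      tail []           h [-]     = [-]
      tail {r ∷ _} (r≢c ∷ ts≢) h (_ ∷ l) =
        (λ _ r<c → contradiction (below r r≢c r<c) (h refl)) ∷ rising-suc (r≢c ∷ ts≢) l

    extract : ∀ {u r} zs ys → Mark c u r → w ≡ zs ++ u ++ r ∷ ys →
              ∃[ v ] Move c (just r) v w × State (suc (toℕ c)) v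
    extract {u} {r} zs ys m refl with maximalSuffix (fits? c r) zs
    ... | xs , rs , refl , end , fs =
      xs ++ r ∷ ys , insert xs rs ys m rs-sorted fs refl w≡ , record
        { unique   = v-unique
        ; abs-inj  = λ x∈ y∈ → abs-inj (v⊆w x∈) (v⊆w y∈)
        ; rising   = linked-++⁺ (rising-suc xs≢ xs-rising) junction
                       (tail m (proj₂ (others m refl)) (linked-++⁻ʳ u (linked-++⁻ʳ (xs ++ rs) rising)))
        ; complete = v-complete
        }
      where
      w≡ : w ≡ xs ++ rs ++ u ++ r ∷ ys
      w≡ = List.++-assoc xs rs (u ++ r ∷ ys)

      v-unique : Unique (xs ++ r ∷ ys)
      v-unique = unique-++⁻ʳ u (unique-++⁻ʳ rs
        (unique-resp-↭ (insertion-↭ xs rs u (r ∷ ys)) (subst Unique w≡ unique)))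

      v⊆w : ∀ {x} → x ∈ xs ++ r ∷ ys → x ∈ w
      v⊆w x∈ = subst (_ ∈_) (sym w≡) (∈-insertion⁺ xs rs u (r ∷ ys) (inj₂ (inj₂ x∈)))

      others : ∀ {u} → Mark c u r → w ≡ (xs ++ rs) ++ u ++ r ∷ ys →
               All (λ x → abs x ≢ c) (xs ++ rs) × All (λ x → abs x ≢ c) ys
      others diagonal  eq = abs-≢ (xs ++ rs) eq refl
      others (arrow _) eq = map₂ All.tail (abs-≢ (xs ++ rs) eq refl)

      xs≢ : All (λ x → abs x ≢ c) xs
      xs≢ = All.++⁻ˡ xs (proj₁ (others m refl))

      xs-rising : Linked (Rises (toℕ c)) xs
      xs-rising = linked-++⁻ˡ xs (linked-++⁻ˡ (xs ++ rs) rising)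

      rs-sorted : Sorted rs
      rs-sorted = Linked.Linked⇒AllPairs ≺-trans
        (linked-refine (λ (x<c , _) (y<c , _) p → p x<c y<c) fs
          (linked-++⁻ʳ xs (linked-++⁻ˡ (xs ++ rs) rising)))

      junction : ∀ {us y} → xs ≡ us ∷ʳ y → Rises (suc (toℕ c)) y r
      junction {us} {y} refl y<c _ = ≺-connex
        (λ { refl → unique-∉ˡ (us ∷ʳ y) v-unique (Mem.∈-++⁺ʳ us (here refl)) })
        (λ r≺y → end refl (below y (All.head (All.++⁻ʳ us xs≢)) y<c , r≺y))

      tail : ∀ {u r} → Mark c u r → All (λ x → abs x ≢ c) ys → Linked (Rises (toℕ c)) (r ∷ ys) →
             Linked (Rises (suc (toℕ c))) (r ∷ ys)
      tail (arrow r<c) ys≢ l = rising-suc ((λ { refl → ℕ.<-irrefl refl r<c }) ∷ ys≢) l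
      tail diagonal ys≢ l = diagonal-tail ys≢ l
        where
        diagonal-tail : ∀ {ys} → All (λ x → abs x ≢ c) ys → Linked (Rises (toℕ c)) (neg c ∷ ys) →
                        Linked (Rises (suc (toℕ c))) (neg c ∷ ys)
        diagonal-tail []          [-]     = [-]
        diagonal-tail {y ∷ _} (y≢c ∷ ys≢) (_ ∷ l) = (λ _ y<c → neg≺ (below y y≢c y<c)) ∷ rising-suc (y≢c ∷ ys≢) l

      v-complete : ∀ i → suc (toℕ c) ≤ toℕ i → ∃[ x ] x ∈ xs ++ r ∷ ys × abs x ≡ i
      v-complete i c<i with complete i (ℕ.<⇒≤ c<i)
      ... | x , x∈ , refl with ∈-insertion⁻ xs rs u (r ∷ ys) (subst (x ∈_) w≡ x∈)
      ...   | inj₁ x∈rs = contradiction (proj₁ (All.lookup fs x∈rs)) (ℕ.<⇒≯ c<i)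
      ...   | inj₂ (inj₁ x∈u) = contradiction c<i (ℕ.<-irrefl (cong toℕ (sym (mark-abs m x∈u))))
        where
        mark-abs : ∀ {u r x} → Mark c u r → x ∈ u → abs x ≡ c
        mark-abs (arrow _) (here refl) = refl
      ...   | inj₂ (inj₂ x∈v) = x , x∈v , refl

    reverse-move : ∃₂ λ d v → Move c d v w × State (suc (toℕ c)) v
    reverse-move with complete c ℕ.≤-refl
    ... | neg _ , x∈ , refl with Mem.∈-∃++ x∈
    ...   | zs , ys , eq = just (neg c) , extract zs ys diagonal eq
    reverse-move | pos _ , x∈ , refl with Mem.∈-∃++ x∈
    ...   | zs , [] , eq = nothing , w , skip x∈ , skip-state zs eq λ ()
    ...   | zs , r ∷ ys , eq with ∣ r ∣ ℕ.<? toℕ c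
    ...     | yes r<c = just r , extract zs ys (arrow r<c) eq
    ...     | no  r≮c = nothing , w , skip x∈ , skip-state zs eq λ { refl → r≮c }

-- Runs

descend : ∀ {A : Set} n {P : ℕ → A → Set} {Q : Fin n → A → A → Set} →
          (∀ c {v} → P (suc (toℕ c)) v → ∃[ w ] P (toℕ c) w × Q c v w) → ∀ {v} → P n v →
          Σ[ f ∈ (ℕ → A) ] f n ≡ v × (∀ {k} → k ≤ n → P k (f k)) × (∀ c → Q c (f (suc (toℕ c))) (f (toℕ c)))
descend zero    next {v} p = (λ _ → v) , refl , (λ { z≤n → p }) , λ ()
descend (suc n) {P} {Q} next p with descend n {P ∘ suc} {Q ∘ Fin.suc} (λ c → next (Fin.suc c)) p
... | f , eq , ps , qs with next Fin.zero (ps z≤n)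
...   | w , pw , qw = (λ { zero → w ; (suc k) → f k }) , eq ,
        (λ { z≤n → pw ; (s≤s k≤n) → ps k≤n }) , λ { Fin.zero → qw ; (Fin.suc c) → qs c }

ascend : ∀ {A : Set} n {P : ℕ → A → Set} {Q : Fin n → A → A → Set} →
         (∀ c {w} → P (toℕ c) w → ∃[ v ] P (suc (toℕ c)) v × Q c v w) → ∀ {w} → P 0 w →
         Σ[ f ∈ (ℕ → A) ] f 0 ≡ w × (∀ {k} → k ≤ n → P k (f k)) × (∀ c → Q c (f (suc (toℕ c))) (f (toℕ c)))
ascend zero    next {w} p = (λ _ → w) , refl , (λ { z≤n → p }) , λ ()
ascend (suc n) {P} {Q} next {w} p with next Fin.zero p
... | v , pv , qv with ascend n {P ∘ suc} {Q ∘ Fin.suc} (λ c → next (Fin.suc c)) pv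
...   | f , refl , ps , qs = (λ { zero → w ; (suc k) → f k }) , refl ,
        (λ { z≤n → p ; (s≤s k≤n) → ps k≤n }) , λ { Fin.zero → qv ; (Fin.suc c) → qs c }

≤-induction : ∀ n {P : ℕ → Set} → P 0 → (∀ (c : Fin n) → P (toℕ c) → P (suc (toℕ c))) →
              ∀ {k} → k ≤ n → P k
≤-induction n       p next z≤n       = p
≤-induction (suc n) p next (s≤s k≤n) = ≤-induction n (next Fin.zero p) (next ∘ Fin.suc) k≤n

module _ {n : ℕ} where

  record Run (w : ℕ → List (Letter n)) (d : Fin n → Maybe (Letter n)) : Set where
    field
      state : ∀ {k} → k ≤ n → State k (w k)
      move  : ∀ c → Move c (d c) (w (suc (toℕ c))) (w (toℕ c))

  module _ {w w′ d d′} (ρ : Run w d) (ρ′ : Run w′ d′) where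
    open Run

    runs-agree-at : ∀ c → w (toℕ c) ≡ w′ (toℕ c) →
                    d c ≡ d′ c × w (suc (toℕ c)) ≡ w′ (suc (toℕ c))
    runs-agree-at c eq = move-deterministic (state ρ (ℕ.<⇒≤ (Fin.toℕ<n c)))
      (state ρ (Fin.toℕ<n c)) (state ρ′ (Fin.toℕ<n c)) (move ρ c)
      (subst (Move c (d′ c) _) (sym eq) (move ρ′ c))

    runs-agree : w 0 ≡ w′ 0 → ∀ {k} → k ≤ n → w k ≡ w′ k
    runs-agree eq = ≤-induction n eq λ c → proj₂ ∘ runs-agree-at c

  insertBefore-split : ∀ {x : Letter n} {us} xs {ys} → x ∉ xs →
                       insertBefore x us (xs ++ x ∷ ys) ≡ just (xs ++ us ++ x ∷ ys)
  insertBefore-split {x} [] x∉ with x ≟ x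
  ... | yes _ = refl
  ... | no x≢x = contradiction refl x≢x
  insertBefore-split {x} {us} (y ∷ xs) {ys} x∉ with x ≟ y
  ... | yes refl = contradiction (here refl) x∉
  ... | no _ rewrite insertBefore-split {x} {us} xs {ys} (x∉ ∘ there) = refl

  cell-< : ∀ {C : Subset n} r {c} → Cell C r c → r ≢ neg c → ∣ r ∣ < toℕ c
  cell-< (pos i) (_ , _ , i<c) _   = i<c
  cell-< (neg j) (_ , _ , j≤c) r≢c = ℕ.≤∧≢⇒< j≤c (r≢c ∘ cong neg ∘ Fin.toℕ-injective)

  module _ (T : Filling n) where
    open Filling T

    Top : Letter n → Fin n → Set
    Top r c = One T r c × ¬ OneAbove T r c

    top-unique : ∀ {r r′ c} → Top r c → Top r′ c → r ≡ r′
    top-unique (o , a) (o′ , a′) = ≺-antisym (λ p → a′ (_ , p , o)) (λ p → a (_ , p , o′))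

    leftArrows : Fin n → List (Letter n)
    leftArrows c = select (λ r → leftArrow? T r c)

    step-insert : ∀ {r u c} xs {ys} → Top r c → Mark c u r → r ∉ xs → pos c ∉ xs →
                  step T c (xs ++ r ∷ ys) ≡ just (xs ++ leftArrows c ++ u ++ r ∷ ys)
    step-insert {r} {u} {c} xs {ys} top m r∉ c∉ with any? (λ r → upArrow? T r c)
    step-insert xs top diagonal r∉ c∉ | yes (_ , top′ , ≢neg) = contradiction (top-unique top′ top) ≢neg
    step-insert xs top diagonal r∉ c∉ | no _ = insertBefore-split xs r∉
    step-insert xs top (arrow r<c) r∉ c∉ | no ¬up =
      contradiction (_ , top , λ { refl → ℕ.<-irrefl refl r<c }) ¬up
    step-insert {r} {u} {c} xs {ys} top (arrow r<c) r∉ c∉ | yes (_ , top′ , _)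
      with refl ← top-unique top top′
      rewrite insertBefore-split {r} {[ pos c ]} xs {ys} r∉ = insertBefore-split xs c∉

    record Trace (w : ℕ → List (Letter n)) : Set where
      field
        start : w n ≡ select (unrestrictedRow? T)
        steps : ∀ c → c ∈ₛ columns → step T c (w (suc (toℕ c))) ≡ just (w (toℕ c))
        rests : ∀ c → c ∉ₛ columns → w (suc (toℕ c)) ≡ w (toℕ c)

    module _ {w} (τ : Trace w) where
      open Trace τ

      foldr-steps : ∀ {m} (g : Fin m → Fin n) k → (∀ i → toℕ (g i) ≡ k ℕ.+ toℕ i) →
                    foldr (λ c w → w >>= step T c) (just (w (k ℕ.+ m)))
                          (filter (_∈? columns) (tabulate g)) ≡ just (w k)
      foldr-steps {zero}  g k g≡ = cong (just ∘ w) (ℕ.+-identityʳ k)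
      foldr-steps {suc m} g k g≡
        with g Fin.zero ∈? columns
           | foldr-steps (g ∘ Fin.suc) (suc k) (λ i → trans (g≡ (Fin.suc i)) (ℕ.+-suc k (toℕ i)))
           | trans (g≡ Fin.zero) (ℕ.+-identityʳ k)
      ... | yes c∈ | ih | refl rewrite ℕ.+-suc (toℕ (g Fin.zero)) m | ih = steps _ c∈
      ... | no c∉  | ih | refl rewrite ℕ.+-suc (toℕ (g Fin.zero)) m | ih = cong just (rests _ c∉)

      trace⇒fold : foldr (λ c w → w >>= step T c) (just (select (unrestrictedRow? T)))
                         (filter (_∈? columns) (allFin n)) ≡ just (w 0)
      trace⇒fold = trans
        (cong (λ v → foldr (λ c w → w >>= step T c) (just v) (filter (_∈? columns) (allFin n))) (sym start))
        (foldr-steps (λ c → c) 0 λ _ → refl)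

-- From tableaux to runs

module _ {n : ℕ} where

  data Column (T : Filling n) (c : Fin n) : Maybe (Letter n) → Set where
    none : c ∉ₛ Filling.columns T → Column T c nothing
    top  : ∀ {r} → Top T r c → Column T c (just r)

  module _ (T : PT n) where
    open PT T renaming (filling to F; columns to C)

    -- The letters of the word at stage k.  A row whose diagonal cell is a
    -- restricted 0 never enters it, and is replaced by its column label.
    Alive : ℕ → Letter n → Set
    Alive k x = (IsRow C x × (∀ {c} → Restricted F x c → k ≤ toℕ c × x ≢ neg c))
              ⊎ (∃[ c ] x ≡ pos c × k ≤ toℕ c × Zero F (neg c) c)

    one-right-of-restricted : ∀ {r c c′} → One F r c → Restricted F r c′ → toℕ c < toℕ c′
    one-right-of-restricted {r} {c} {c′} one (zero′ , why) with Fin.<-cmp c c′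
    ... | tri< c<c′ _ _ = c<c′
    ... | tri≈ _ refl _ = case trans (sym (proj₂ one)) (proj₂ zero′) of λ ()
    one-right-of-restricted {r} {c} {c′} one (zero′ , inj₁ above) | tri> _ _ c′<c =
      ⊥-elim (zero-condition r c′ zero′ (above , c , c′<c , one))
    one-right-of-restricted {r} {c} {c′} one (zero′ , inj₂ refl) | tri> _ _ c′<c =
      ⊥-elim (diag-condition c′ zero′ (c , c′<c , one))

    one⇒alive : ∀ {r c} → One F r c → Alive (suc (toℕ c)) r
    one⇒alive one@(cell , _) = inj₁ (proj₁ cell , λ ρ →
      one-right-of-restricted one ρ ,
      λ { refl → ℕ.<⇒≱ (one-right-of-restricted one ρ) (proj₂ (proj₂ cell)) })

    alive⇒one : ∀ {r r₀ c} → Cell C r c → Top F r₀ c → Alive (suc (toℕ c)) r → ¬ r ≺ r₀ → One F r c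
    alive⇒one {r} {r₀} {c} cell (one₀ , _) alive r⊀r₀ with entry r c in eq
    ... | 1F = cell , refl
    ... | 0F with r ≟ r₀
    ...   | yes refl = case trans (sym eq) (proj₂ one₀) of λ ()
    ...   | no r≢r₀  with alive
    ...     | inj₁ (_ , h) = contradiction
                (proj₁ (h ((cell , eq) , inj₁ (r₀ , ≺-connex r≢r₀ r⊀r₀ , one₀)))) (ℕ.<-irrefl refl)
    ...     | inj₂ (_ , refl , _ , (c∈ , _) , _) = contradiction c∈ (proj₁ cell)

    alive-abs-inj : ∀ {k x y} → Alive k x → Alive k y → abs x ≡ abs y → x ≡ y
    alive-abs-inj {x = pos _} {pos _} _ _ refl = refl
    alive-abs-inj {x = neg _} {neg _} _ _ refl = refl
    alive-abs-inj {x = pos i} {neg i} (inj₁ (i∉ , _)) (inj₁ (i∈ , _)) refl = contradiction i∈ i∉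
    alive-abs-inj {x = pos i} {neg i} (inj₂ (i , refl , _ , z)) (inj₁ (_ , h)) refl =
      contradiction refl (proj₂ (h (z , inj₂ refl)))
    alive-abs-inj {x = neg i} {pos i} (inj₁ (i∈ , _)) (inj₁ (i∉ , _)) refl = contradiction i∈ i∉
    alive-abs-inj {x = neg i} {pos i} (inj₁ (_ , h)) (inj₂ (i , refl , _ , z)) refl =
      contradiction refl (proj₂ (h (z , inj₂ refl)))

    alive-complete : ∀ {k} i → k ≤ toℕ i → ∃[ x ] Alive k x × abs x ≡ i
    alive-complete {k} i k≤i with i ∈? C
    ... | no i∉ = pos i ,
      inj₁ (i∉ , λ ρ → ℕ.≤-trans k≤i (ℕ.<⇒≤ (proj₂ (proj₂ (proj₁ (proj₁ ρ))))) , λ ()) , refl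
    ... | yes i∈ with entry (neg i) i in eq
    ...   | 0F = pos i , inj₂ (i , refl , k≤i , (i∈ , i∈ , ℕ.≤-refl) , eq) , refl
    ...   | 1F = neg i , inj₁ (i∈ , λ ρ →
      ℕ.≤-trans k≤i (proj₂ (proj₂ (proj₁ (proj₁ ρ)))) ,
      λ { refl → case trans (sym eq) (proj₂ (proj₁ ρ)) of λ () }) , refl

    alive-suc : ∀ {k x} → Alive (suc k) x → Alive k x
    alive-suc (inj₁ (row , h)) = inj₁ (row , λ ρ → ℕ.<⇒≤ (proj₁ (h ρ)) , proj₂ (h ρ))
    alive-suc (inj₂ (c , eq , k<c , z)) = inj₂ (c , eq , ℕ.<⇒≤ k<c , z)

    ¬alive-pos : ∀ {c} → c ∈ₛ C → ¬ Alive (suc (toℕ c)) (pos c)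
    ¬alive-pos c∈ (inj₁ (c∉ , _)) = c∉ c∈
    ¬alive-pos c∈ (inj₂ (_ , refl , c<c , _)) = ℕ.<-irrefl refl c<c

    leftArrow⇒¬alive : ∀ {c x} → LeftArrow F x c → ¬ Alive (suc (toℕ c)) x
    leftArrow⇒¬alive ((ρ , _) , _) (inj₁ (_ , h)) = ℕ.<-irrefl refl (proj₁ (h ρ))
    leftArrow⇒¬alive ((ρ , _) , _) (inj₂ (_ , refl , _ , (c∈ , _) , _)) = proj₁ (proj₁ (proj₁ ρ)) c∈

    alive-skip : ∀ {c x} → c ∉ₛ C → Alive (toℕ c) x → Alive (suc (toℕ c)) x
    alive-skip {c} c∉ (inj₁ (row , h)) = inj₁ (row , λ ρ →
      ℕ.≤∧≢⇒< (proj₁ (h ρ)) (other (proj₁ (proj₂ (proj₁ (proj₁ ρ))))) , proj₂ (h ρ))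
      where
      other : ∀ {c′} → c′ ∈ₛ C → toℕ c ≢ toℕ c′
      other c′∈ eq with refl ← Fin.toℕ-injective eq = c∉ c′∈
    alive-skip {c} c∉ (inj₂ (c′ , eq , c≤c′ , z)) =
      inj₂ (c′ , eq , ℕ.≤∧≢⇒< c≤c′ other , z)
      where
      other : toℕ c ≢ toℕ c′
      other eq with refl ← Fin.toℕ-injective eq = c∉ (proj₁ (proj₁ z))

    module _ {r c} (topr : Top F r c) where

      private
        c∈C : c ∈ₛ C
        c∈C = proj₁ (proj₂ (proj₁ (proj₁ topr)))

      top-mark : ∃[ u ] Mark c u r
      top-mark with r ≟ neg c
      ... | yes refl = [] , diagonal
      ... | no r≢    = [ pos c ] , arrow (cell-< r (proj₁ (proj₁ topr)) r≢)

      leftArrow-fits : ∀ {x} → LeftArrow F x c → Fits c r x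
      leftArrow-fits {x} (((zero′ , inj₂ x≡) , _) , x≢) = contradiction x≡ x≢
      leftArrow-fits {x} (((zero′ , inj₁ (r′ , r′≺x , one)) , _) , x≢) =
        cell-< x (proj₁ zero′) x≢ , ⊀-≺-trans (λ p → proj₂ topr (r′ , p , one)) r′≺x

      arrow⇒zero : ∣ r ∣ < toℕ c → Zero F (neg c) c
      arrow⇒zero r<c with entry (neg c) c in eq
      ... | 0F = (c∈C , c∈C , ℕ.≤-refl) , refl
      ... | 1F = contradiction (neg c , neg≺ r<c , (c∈C , c∈C , ℕ.≤-refl) , eq) (proj₂ topr)

      alive-insert⁻ : ∀ {u x} → Mark c u r → Alive (toℕ c) x →
                      x ∈ leftArrows F c ⊎ x ∈ u ⊎ Alive (suc (toℕ c)) x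
      alive-insert⁻ {u} {x} m (inj₁ (row , h)) with restricted? F x c
      ... | yes ρ = inj₁ (∈-select⁺ (λ r → leftArrow? F r c)
                      ((ρ , λ (c′ , c′<c , ρ′) → ℕ.<⇒≱ c′<c (proj₁ (h ρ′))) , proj₂ (h ρ)))
      ... | no ¬ρ = inj₂ (inj₂ (inj₁ (row , λ {c′} ρ′ →
                      ℕ.≤∧≢⇒< (proj₁ (h ρ′)) (λ eq → ¬ρ (subst (Restricted F x) (sym (Fin.toℕ-injective eq)) ρ′)) ,
                      proj₂ (h ρ′))))
      alive-insert⁻ m (inj₂ (c′ , refl , c≤c′ , z)) with c Fin.≟ c′
      ... | no c≢c′ = inj₂ (inj₂ (inj₂ (c′ , refl , ℕ.≤∧≢⇒< c≤c′ (c≢c′ ∘ Fin.toℕ-injective) , z)))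
      alive-insert⁻ (arrow _) (inj₂ (c′ , refl , c≤c′ , z)) | yes refl = inj₂ (inj₁ (here refl))
      alive-insert⁻ diagonal (inj₂ (c′ , refl , c≤c′ , z)) | yes refl =
        case trans (sym (proj₂ z)) (proj₂ (proj₁ topr)) of λ ()

      alive-insert⁺ : ∀ {u x} → Mark c u r → x ∈ leftArrows F c ⊎ x ∈ u ⊎ Alive (suc (toℕ c)) x →
                      Alive (toℕ c) x
      alive-insert⁺ (arrow r<c) (inj₂ (inj₁ (here refl))) = inj₂ (c , refl , ℕ.≤-refl , arrow⇒zero r<c)
      alive-insert⁺ m (inj₂ (inj₂ alive)) = alive-suc alive
      alive-insert⁺ {x = x} m (inj₁ x∈) with ∈-select⁻ (λ r → leftArrow? F r c) x∈
      ... | (ρ , rightmost) , x≢ = inj₁ (proj₁ (proj₁ (proj₁ ρ)) , λ {c′} ρ′ →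
        ℕ.≮⇒≥ (λ c′<c → rightmost (c′ , c′<c , ρ′)) , not-diagonal ρ′)
        where
        not-diagonal : ∀ {c′} → Restricted F x c′ → x ≢ neg c′
        not-diagonal {c′} ρ′ refl = rightmost
          (c′ , ℕ.≤∧≢⇒< (proj₂ (proj₂ (proj₁ (proj₁ ρ)))) (x≢ ∘ cong neg ∘ Fin.toℕ-injective) , ρ′)

    record Stage (k : ℕ) (w : List (Letter n)) : Set where
      field
        unique : Unique w
        rising : Linked (Rises k) w
        alive⁻ : ∀ {x} → x ∈ w → Alive k x
        alive⁺ : ∀ {x} → Alive k x → x ∈ w

      state : State k w
      state = record
        { unique   = unique
        ; abs-inj  = λ x∈ y∈ → alive-abs-inj (alive⁻ x∈) (alive⁻ y∈)
        ; rising   = rising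
        ; complete = λ i k≤i → case alive-complete i k≤i of λ { (x , a , eq) → x , alive⁺ a , eq }
        }

    record Advance (c : Fin n) (v w : List (Letter n)) : Set where
      field
        {top?} : Maybe (Letter n)
        column : Column F c top?
        move   : Move c top? v w

    advance-insert : ∀ {r c u} xs ys → Top F r c → Mark c u r → Stage (suc (toℕ c)) (xs ++ r ∷ ys) →
                     ∃[ w ] Stage (toℕ c) w × Advance c (xs ++ r ∷ ys) w
    advance-insert {r} {c} {u} xs ys topr m S = w , stage , record
      { column = top topr
      ; move   = insert xs rs ys m rs-sorted fits refl refl
      }
      where
      open Stage S
      rs w : List (Letter n)
      rs = leftArrows F c
      w  = xs ++ rs ++ u ++ r ∷ ys

      c∈C : c ∈ₛ C
      c∈C = proj₁ (proj₂ (proj₁ (proj₁ topr)))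

      left : ∀ {x} → x ∈ rs → LeftArrow F x c
      left = ∈-select⁻ (λ r → leftArrow? F r c)

      rs-sorted : Sorted rs
      rs-sorted = select-sorted (λ r → leftArrow? F r c)

      fits : All (Fits c r) rs
      fits = All.tabulate (leftArrow-fits topr ∘ left)

      marked : ∀ {u x r} → Mark c u r → x ∈ u → x ≡ pos c
      marked (arrow _) (here refl) = refl

      mark-unique : ∀ {u r} → Mark c u r → Unique u
      mark-unique diagonal  = []
      mark-unique (arrow _) = [] ∷ []

      w-unique : Unique w
      w-unique = unique-resp-↭ (↭-sym (insertion-↭ xs rs u (r ∷ ys)))
        (Unique.++⁺ (sorted⇒unique rs-sorted)
          (Unique.++⁺ (mark-unique m) unique
            (λ (x∈u , x∈v) → ¬alive-pos c∈C (subst (Alive _) (marked m x∈u) (alive⁻ x∈v))))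
          (λ (x∈rs , x∈) → fresh x∈rs (Mem.∈-++⁻ u x∈)))
        where
        fresh : ∀ {x} → x ∈ rs → ¬ (x ∈ u ⊎ x ∈ xs ++ r ∷ ys)
        fresh x∈rs (inj₂ x∈v) = leftArrow⇒¬alive (left x∈rs) (alive⁻ x∈v)
        fresh x∈rs (inj₁ x∈u) with refl ← marked m x∈u = ℕ.<-irrefl refl (proj₁ (All.lookup fits x∈rs))

      stage : Stage (toℕ c) w
      stage = record
        { unique = w-unique
        ; rising = insert-rising xs rs ys m rs-sorted fits rising
        ; alive⁻ = alive-insert⁺ topr m ∘ Sum.map₂ (Sum.map₂ alive⁻) ∘ ∈-insertion⁻ xs rs u (r ∷ ys)
        ; alive⁺ = ∈-insertion⁺ xs rs u (r ∷ ys) ∘ Sum.map₂ (Sum.map₂ alive⁺) ∘ alive-insert⁻ topr m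
        }

    advance : ∀ c {v} → Stage (suc (toℕ c)) v → ∃[ w ] Stage (toℕ c) w × Advance c v w
    advance c {v} S with c ∈? C
    ... | no c∉ = v , stage , record
      { column = none c∉
      ; move   = skip (alive⁺ (inj₁ (c∉ , λ ρ → proj₂ (proj₂ (proj₁ (proj₁ ρ))) , λ ())))
      }
      where
      open Stage S
      stage : Stage (toℕ c) v
      stage = record
        { unique = unique
        ; rising = Linked.map rises-weaken rising
        ; alive⁻ = alive-suc ∘ alive⁻
        ; alive⁺ = alive⁺ ∘ alive-skip c∉
        }
    ... | yes c∈ with minimum (λ r → one? F r c) (column-has-one c c∈)
    ...   | r , one , least with Mem.∈-∃++ (Stage.alive⁺ S (one⇒alive one))
    ...     | xs , ys , refl = advance-insert xs ys topr (proj₂ (top-mark topr)) S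
      where
      topr : Top F r c
      topr = one , λ (r′ , r′≺r , one′) → least one′ r′≺r

    initial : Stage n (select (unrestrictedRow? F))
    initial = record
      { unique = sorted⇒unique (select-sorted (unrestrictedRow? F))
      ; rising = Linked.map (λ p _ _ → p) (Linked.AllPairs⇒Linked (select-sorted (unrestrictedRow? F)))
      ; alive⁻ = unrestricted⇒alive ∘ ∈-select⁻ (unrestrictedRow? F)
      ; alive⁺ = λ { (inj₁ (row , h)) → ∈-select⁺ (unrestrictedRow? F)
                       (row , λ (c , ρ) → ℕ.<⇒≱ (Fin.toℕ<n c) (proj₁ (h ρ)))
                   ; (inj₂ (c , _ , n≤c , _)) → contradiction n≤c (ℕ.<⇒≱ (Fin.toℕ<n c)) }
      }
      where
      unrestricted⇒alive : ∀ {x} → UnrestrictedRow F x → Alive n x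
      unrestricted⇒alive (row , free) = inj₁ (row , λ {c} ρ → contradiction (c , ρ) free)

    record Traced (w : ℕ → List (Letter n)) (d : Fin n → Maybe (Letter n)) : Set where
      field
        stage  : ∀ {k} → k ≤ n → Stage k (w k)
        column : ∀ c → Column F c (d c)
        run    : Run w d

    traced : ∃₂ Traced
    traced with descend n {Stage} {Advance} advance initial
    ... | w , _ , stages , advances = w , (λ c → Advance.top? (advances c)) , record
      { stage  = stages
      ; column = λ c → Advance.column (advances c)
      ; run    = record { state = Stage.state ∘ stages ; move = λ c → Advance.move (advances c) }
      }

-- From runs to tableaux

module _ {n : ℕ} where

  module _ (w : ℕ → List (Letter n)) (d : Fin n → Maybe (Letter n)) where

    OneAt : Letter n → Fin n → Set
    OneAt r c = ∃[ r₀ ] d c ≡ just r₀ × r ∈ w (suc (toℕ c)) × ¬ r ≺ r₀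

    record Realizes (F : Filling n) : Set where
      open Filling F
      field
        column⁻ : ∀ {c} → c ∈ₛ columns → ∃[ r ] d c ≡ just r
        column⁺ : ∀ {c r} → d c ≡ just r → c ∈ₛ columns
        one⁻    : ∀ {r c} → One F r c → OneAt r c
        one⁺    : ∀ {r c} → Cell columns r c → OneAt r c → One F r c

  record Insertion (c : Fin n) (r : Letter n) (v w : List (Letter n)) : Set where
    field
      {rs u} : List (Letter n)
      xs ys  : List (Letter n)
      mark   : Mark c u r
      sorted : Sorted rs
      fits   : All (Fits c r) rs
      v≡     : v ≡ xs ++ r ∷ ys
      w≡     : w ≡ xs ++ rs ++ u ++ r ∷ ys

    w↭ : w ↭ rs ++ u ++ v
    w↭ = subst₂ (λ w v → w ↭ rs ++ u ++ v) (sym w≡) (sym v≡) (insertion-↭ xs rs u (r ∷ ys))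

    ∈w⁻ : ∀ {x} → x ∈ w → x ∈ rs ⊎ x ∈ u ⊎ x ∈ v
    ∈w⁻ x∈ = Sum.map₂ (Mem.∈-++⁻ u) (Mem.∈-++⁻ rs (∈-resp-↭ w↭ x∈))

    ∈w⁺ : ∀ {x} → x ∈ rs ⊎ x ∈ u ⊎ x ∈ v → x ∈ w
    ∈w⁺ x∈ = ∈-resp-↭ (↭-sym w↭) (Sum.[ Mem.∈-++⁺ˡ , Mem.∈-++⁺ʳ rs ∘ Sum.[ Mem.∈-++⁺ˡ , Mem.∈-++⁺ʳ u ] ] x∈)

    module _ (w-unique : Unique w) where

      v-unique : Unique v
      v-unique = unique-++⁻ʳ u (unique-++⁻ʳ rs (unique-resp-↭ w↭ w-unique))

      rs-fresh : ∀ {x} → x ∈ rs → x ∉ v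
      rs-fresh x∈rs x∈v = unique-disjoint rs (unique-resp-↭ w↭ w-unique) x∈rs (Mem.∈-++⁺ʳ u x∈v)

      u-fresh : ∀ {x} → x ∈ u → x ∉ v
      u-fresh x∈u x∈v = unique-disjoint u (unique-++⁻ʳ rs (unique-resp-↭ w↭ w-unique)) x∈u x∈v

  move⇒insertion : ∀ {c : Fin n} {d r v w} → Move c d v w → d ≡ just r → Insertion c r v w
  move⇒insertion (insert xs rs ys m s f v≡ w≡) refl = record
    { xs = xs ; ys = ys ; mark = m ; sorted = s ; fits = f ; v≡ = v≡ ; w≡ = w≡ }

  move-⊆ : ∀ {c : Fin n} {d v w x} → Move c d v w → x ∈ v → x ∈ w
  move-⊆ (skip _) x∈ = x∈
  move-⊆ m@(insert _ _ _ _ _ _ _ _) x∈ = Insertion.∈w⁺ (move⇒insertion m refl) (inj₂ (inj₂ x∈))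

  mark-∈ : ∀ {c : Fin n} {u r x} → Mark c u r → x ∈ u → x ≡ pos c
  mark-∈ (arrow _) (here refl) = refl

  move-new : ∀ {c : Fin n} {d v w x} → Move c d v w → x ∈ w → x ∉ v →
             ∃[ r ] d ≡ just r × (x ≡ pos c ⊎ Fits c r x)
  move-new (skip _) x∈ x∉ = contradiction x∈ x∉
  move-new m@(insert _ _ _ mk _ fs _ _) x∈ x∉ with Insertion.∈w⁻ (move⇒insertion m refl) x∈
  ... | inj₁ x∈rs       = _ , refl , inj₂ (All.lookup fs x∈rs)
  ... | inj₂ (inj₁ x∈u) = _ , refl , inj₁ (mark-∈ mk x∈u)
  ... | inj₂ (inj₂ x∈v) = contradiction x∈v x∉

  move-neg : ∀ {c : Fin n} {d v w} → State (toℕ c) w → Move c d v w → neg c ∈ w → d ≡ just (neg c)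
  move-neg S (skip p∈) n∈ = ⊥-elim (¬pos∈×neg∈ S p∈ n∈)
  move-neg S (insert _ _ _ diagonal _ _ _ _) n∈ = refl
  move-neg S (insert xs rs _ (arrow _) _ _ _ refl) n∈ =
    ⊥-elim (¬pos∈×neg∈ S (Mem.∈-++⁺ʳ xs (Mem.∈-insert rs)) n∈)

  move-rest : ∀ {c : Fin n} {d v w} → Move c d v w → (∀ {r} → d ≢ just r) → v ≡ w
  move-rest (skip _)                   _   = refl
  move-rest (insert _ _ _ _ _ _ _ _) d≢ = contradiction refl d≢

  module _ {w : ℕ → List (Letter n)} {d : Fin n → Maybe (Letter n)} (ρ : Run w d) where
    open Run ρ
    open DecMembership (_≟_ {n}) using () renaming (_∈?_ to _∈ₗ?_)

    private
      toℕ≤n : ∀ (c : Fin n) → toℕ c ≤ n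
      toℕ≤n c = ℕ.<⇒≤ (Fin.toℕ<n c)

      insertion : ∀ {c r} → d c ≡ just r → Insertion c r (w (suc (toℕ c))) (w (toℕ c))
      insertion {c} = move⇒insertion (move c)

      unique-at : ∀ c → Unique (w (toℕ c))
      unique-at c = State.unique (state (toℕ≤n c))

    shrinking : ∀ {j k x} → j ≤ k → k ≤ n → x ∈ w k → x ∈ w j
    shrinking {x = x} j≤k k≤n = ≤-induction n {λ k → ∀ {j} → j ≤ k → x ∈ w k → x ∈ w j}
      (λ { z≤n x∈ → x∈ }) next k≤n j≤k
      where
      next : ∀ c → (∀ {j} → j ≤ toℕ c → x ∈ w (toℕ c) → x ∈ w j) →
             ∀ {j} → j ≤ suc (toℕ c) → x ∈ w (suc (toℕ c)) → x ∈ w j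
      next c ih j≤sc x∈ with ℕ.m≤n⇒m<n∨m≡n j≤sc
      ... | inj₁ (s≤s j≤c) = ih j≤c (move-⊆ (move c) x∈)
      ... | inj₂ refl      = x∈

    Born : Letter n → Fin n → Set
    Born x c = x ∈ w (toℕ c) × x ∉ w (suc (toℕ c))

    birth : ∀ {x k} → x ∈ w 0 → k ≤ n → x ∈ w k ⊎ ∃[ c ] toℕ c < k × Born x c
    birth {x} x∈0 = ≤-induction n (inj₁ x∈0) next
      where
      next : ∀ c → x ∈ w (toℕ c) ⊎ (∃[ c′ ] toℕ c′ < toℕ c × Born x c′) →
             x ∈ w (suc (toℕ c)) ⊎ (∃[ c′ ] toℕ c′ < suc (toℕ c) × Born x c′)
      next c (inj₂ (c′ , c′<c , b)) = inj₂ (c′ , ℕ.m<n⇒m<1+n c′<c , b)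
      next c (inj₁ x∈) with x ∈ₗ? w (suc (toℕ c))
      ... | yes x∈′ = inj₁ x∈′
      ... | no x∉   = inj₂ (c , ℕ.≤-refl , x∈ , x∉)

    born-fits : ∀ {x c} → Born x c → ∃[ r ] d c ≡ just r × (x ≡ pos c ⊎ Fits c r x)
    born-fits {x} {c} (x∈ , x∉) = move-new (move c) x∈ x∉

    neg∈⇒self-marked : ∀ {j k} → k ≤ n → neg j ∈ w k → d j ≡ just (neg j)
    neg∈⇒self-marked {j} k≤n j∈ with birth (shrinking z≤n k≤n j∈) (Fin.toℕ<n j)
    ... | inj₂ (c , c≤j , b) with born-fits b
    ...   | _ , _ , inj₂ (j<c , _) = contradiction j<c (ℕ.≤⇒≯ (ℕ.≤-pred c≤j))
    neg∈⇒self-marked {j} k≤n j∈ | inj₁ j∈s = move-neg (state (toℕ≤n j)) (move j) (move-⊆ (move j) j∈s)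

    marked⇒pos∉ : ∀ {c r} → d c ≡ just r → pos c ∉ w (suc (toℕ c))
    marked⇒pos∉ {c} eq p∈ with insertion eq
    ... | record { xs = xs ; mark = diagonal ; v≡ = v≡ } =
      ¬pos∈×neg∈ (state (toℕ≤n c)) (move-⊆ (move c) p∈)
        (move-⊆ (move c) (subst (neg c ∈_) (sym v≡) (Mem.∈-insert xs)))
    ... | ins@record { mark = arrow _ } = Insertion.u-fresh ins (unique-at c) (here refl) p∈

    marker∈ : ∀ {c r} → d c ≡ just r → r ∈ w (suc (toℕ c))
    marker∈ eq = subst (_ ∈_) (sym v≡) (Mem.∈-insert xs)
      where open Insertion (insertion eq)

    final-sorted : Sorted (w n)
    final-sorted = Linked.Linked⇒AllPairs ≺-trans
      (Linked.map (λ {x} {y} p → p (Fin.toℕ<n (abs x)) (Fin.toℕ<n (abs y))) (State.rising (state ℕ.≤-refl)))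

    module _ {F : Filling n} (R : Realizes w d F) where
      open Filling F
      open Realizes R

      ∈⇒row : ∀ {x k} → k ≤ n → ∣ x ∣ < k → x ∈ w k → IsRow columns x
      ∈⇒row {pos i} k≤n i<k x∈ i∈ = marked⇒pos∉ (proj₂ (column⁻ i∈)) (shrinking i<k k≤n x∈)
      ∈⇒row {neg j} k≤n _ x∈ = column⁺ (neg∈⇒self-marked k≤n x∈)

      cell : ∀ {x c} → IsRow columns x → c ∈ₛ columns → ∣ x ∣ < toℕ c → Cell columns x c
      cell {pos _} row c∈ x<c = row , c∈ , x<c
      cell {neg _} row c∈ x<c = row , c∈ , ℕ.<⇒≤ x<c

      marked⇒top : ∀ {c r} → d c ≡ just r → Top F r c
      marked⇒top {c} {r} eq = one⁺ (go (Insertion.mark (insertion eq))) (r , eq , marker∈ eq , ≺-irrefl) ,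
        λ (r′ , r′≺r , one) → case one⁻ one of
          λ { (r₀ , eq₀ , _ , r′⊀r₀) → r′⊀r₀ (subst (r′ ≺_) (just-injective (trans (sym eq) eq₀)) r′≺r) }
        where
        go : ∀ {u} → Mark c u r → Cell columns r c
        go diagonal    = column⁺ eq , column⁺ eq , ℕ.≤-refl
        go (arrow r<c) = cell (∈⇒row (Fin.toℕ<n c) (ℕ.m<n⇒m<1+n r<c) (marker∈ eq)) (column⁺ eq) r<c

      restricted⇒∉ : ∀ {x c} → Restricted F x c → x ∉ w (suc (toℕ c))
      restricted⇒∉ {x} {c} ((cl , zero′) , why) x∈ with column⁻ (proj₁ (proj₂ cl))
      ... | r , eq = case trans (sym zero′) (proj₂ (one⁺ cl (r , eq , x∈ , x⊀r why))) of λ ()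
        where
        x⊀r : OneAbove F x c ⊎ x ≡ neg c → ¬ x ≺ r
        x⊀r (inj₁ (r′ , r′≺x , one)) =
          ≺-asym (⊀-≺-trans (λ r′≺r → proj₂ (marked⇒top eq) (r′ , r′≺r , one)) r′≺x)
        x⊀r (inj₂ refl) = subst (λ r → ¬ neg c ≺ r)
          (just-injective (trans (sym (neg∈⇒self-marked (Fin.toℕ<n c) x∈)) eq)) ≺-irrefl

      fits⇒restricted : ∀ {x c r} → d c ≡ just r → IsRow columns x → Fits c r x →
                        x ∉ w (suc (toℕ c)) → Restricted F x c
      fits⇒restricted {x} {c} {r} eq row (x<c , r≺x) x∉ = zero′ , inj₁ (r , r≺x , proj₁ (marked⇒top eq))
        where
        zero′ : Zero F x c
        zero′ with entry x c in e
        ... | 0F = cell row (column⁺ eq) x<c , refl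
        ... | 1F = contradiction (proj₁ (proj₂ (proj₂ (one⁻ (cell row (column⁺ eq) x<c , e))))) x∉

      born⇒restricted : ∀ {x c} → IsRow columns x → Born x c → Restricted F x c
      born⇒restricted row b with born-fits b
      ... | _ , eq , inj₁ refl = contradiction (column⁺ eq) row
      ... | _ , eq , inj₂ fits = fits⇒restricted eq row fits (proj₂ b)

      row⇒∈ : ∀ {x} → IsRow columns x → (∀ {c} → Restricted F x c → x ≢ neg c) → x ∈ w 0
      row⇒∈ {x} row h with State.complete (state z≤n) (abs x) z≤n
      row⇒∈ {pos i} row h | pos _ , y∈ , refl = y∈
      row⇒∈ {neg j} row h | neg _ , y∈ , refl = y∈
      row⇒∈ {pos i} row h | neg _ , y∈ , refl = contradiction (column⁺ (neg∈⇒self-marked z≤n y∈)) row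
      row⇒∈ {neg j} row h | pos _ , y∈ , refl with entry (neg j) j in eq
      ... | 0F = contradiction refl (h (((row , row , ℕ.≤-refl) , eq) , inj₂ refl))
      ... | 1F = case State.abs-inj (state z≤n) y∈ j∈ refl of λ ()
        where
        j∈ : neg j ∈ w 0
        j∈ = shrinking z≤n (Fin.toℕ<n j) (proj₁ (proj₂ (proj₂ (one⁻ ((row , row , ℕ.≤-refl) , eq)))))

      realized-column : ∀ c → c ∈ₛ columns → ∃[ r ] One F r c
      realized-column c c∈ = _ , proj₁ (marked⇒top (proj₂ (column⁻ c∈)))

      restricted⇒¬oneLeft : ∀ {r c} → Restricted F r c → ¬ OneLeft F r c
      restricted⇒¬oneLeft ρ′ (c′ , c<c′ , one) = restricted⇒∉ ρ′
        (shrinking (s≤s (ℕ.<⇒≤ c<c′)) (Fin.toℕ<n c′) (proj₁ (proj₂ (proj₂ (one⁻ one)))))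

      realized-start : w n ≡ select (unrestrictedRow? F)
      realized-start = sym (select-unique (unrestrictedRow? F) final-sorted unrestricted⇒∈ ∈⇒unrestricted)
        where
        unrestricted⇒∈ : ∀ {x} → UnrestrictedRow F x → x ∈ w n
        unrestricted⇒∈ (row , free) with birth (row⇒∈ row (λ {c} ρ′ → contradiction (c , ρ′) free)) ℕ.≤-refl
        ... | inj₁ x∈          = x∈
        ... | inj₂ (c , _ , b) = contradiction (c , born⇒restricted row b) free

        ∈⇒unrestricted : ∀ {x} → x ∈ w n → UnrestrictedRow F x
        ∈⇒unrestricted {x} x∈ = ∈⇒row ℕ.≤-refl (Fin.toℕ<n (abs x)) x∈ ,
          λ (c , ρ′) → restricted⇒∉ ρ′ (shrinking (Fin.toℕ<n c) ℕ.≤-refl x∈)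

      realized-step : ∀ c → c ∈ₛ columns → step F c (w (suc (toℕ c))) ≡ just (w (toℕ c))
      realized-step c c∈ with column⁻ c∈
      ... | r , eq = begin
        step F c (w (suc (toℕ c)))                      ≡⟨ cong (step F c) v≡ ⟩
        step F c (xs ++ r ∷ ys)                         ≡⟨ step-insert F xs (marked⇒top eq) mark r∉ c∉ ⟩
        just (xs ++ leftArrows F c ++ u ++ r ∷ ys)      ≡⟨ cong (λ us → just (xs ++ us ++ u ++ r ∷ ys)) arrows ⟩
        just (xs ++ rs ++ u ++ r ∷ ys)                  ≡⟨ cong just w≡ ⟨
        just (w (toℕ c))                                ∎
        where
        open ≡-Reasoning
        open Insertion (insertion eq)

        r∉ : r ∉ xs
        r∉ = unique-∉ˡ xs (subst Unique v≡ (v-unique (unique-at c)))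

        c∉ : pos c ∉ xs
        c∉ c∈xs = marked⇒pos∉ eq (subst (pos c ∈_) (sym v≡) (Mem.∈-++⁺ˡ c∈xs))

        left⇒∈ : ∀ {x} → LeftArrow F x c → x ∈ rs
        left⇒∈ {x} ((ρ′ , rightmost) , x≢) with birth (row⇒∈ row ¬diagonal) (toℕ≤n c)
          where
          row : IsRow columns x
          row = proj₁ (proj₁ (proj₁ ρ′))

          ¬diagonal : ∀ {c′} → Restricted F x c′ → x ≢ neg c′
          ¬diagonal {c′} ρ″ refl = rightmost
            (c′ , ℕ.≤∧≢⇒< (proj₂ (proj₂ (proj₁ (proj₁ ρ′)))) (x≢ ∘ cong neg ∘ Fin.toℕ-injective) , ρ″)
        ... | inj₂ (c′ , c′<c , b) =
          contradiction (c′ , c′<c , born⇒restricted (proj₁ (proj₁ (proj₁ ρ′))) b) rightmost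
        ... | inj₁ x∈ with ∈w⁻ x∈
        ...   | inj₁ x∈rs = x∈rs
        ...   | inj₂ (inj₂ x∈v) = contradiction x∈v (restricted⇒∉ ρ′)
        ...   | inj₂ (inj₁ x∈u) =
          contradiction c∈ (subst (IsRow columns) (mark-∈ mark x∈u) (proj₁ (proj₁ (proj₁ ρ′))))

        ∈⇒left : ∀ {x} → x ∈ rs → LeftArrow F x c
        ∈⇒left {x} x∈ = (fits⇒restricted eq row x-fits (rs-fresh (unique-at c) x∈) , rightmost) ,
          λ { refl → ℕ.<-irrefl refl (proj₁ x-fits) }
          where
          x-fits : Fits c r x
          x-fits = All.lookup fits x∈

          x∈w : x ∈ w (toℕ c)
          x∈w = ∈w⁺ (inj₁ x∈)

          row : IsRow columns x
          row = ∈⇒row (toℕ≤n c) (proj₁ x-fits) x∈w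

          rightmost : ¬ (∃[ c′ ] toℕ c′ < toℕ c × Restricted F x c′)
          rightmost (c′ , c′<c , ρ′) = restricted⇒∉ ρ′ (shrinking c′<c (toℕ≤n c) x∈w)

        arrows : leftArrows F c ≡ rs
        arrows = select-unique (λ r → leftArrow? F r c) sorted left⇒∈ ∈⇒left

      realized-rest : ∀ c → c ∉ₛ columns → w (suc (toℕ c)) ≡ w (toℕ c)
      realized-rest c c∉ = move-rest (move c) (c∉ ∘ column⁺)

      realized-trace : Trace F w
      realized-trace = record { start = realized-start ; steps = realized-step ; rests = realized-rest }

-- The bijection

module _ {A B : Set} {f : A → B} where

  unique-map⁺ : ∀ {xs} → (∀ {x y} → x ∈ xs → y ∈ xs → f x ≡ f y → x ≡ y) → Unique xs → Unique (map f xs)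
  unique-map⁺ inj []       = []
  unique-map⁺ inj (x∉ ∷ u) =
    All.map⁺ (All.tabulate λ y∈ eq → All.lookup x∉ y∈ (inj (here refl) (there y∈) eq)) ∷
    unique-map⁺ (λ x∈ y∈ → inj (there x∈) (there y∈)) u

  unique-map⁻-injective : ∀ {xs x y} → Unique (map f xs) → x ∈ xs → y ∈ xs → f x ≡ f y → x ≡ y
  unique-map⁻-injective u        (here refl) (here refl) _  = refl
  unique-map⁻-injective (x∉ ∷ _) (here refl) (there y∈)  eq = contradiction eq (All.lookup (All.map⁻ x∉) y∈)
  unique-map⁻-injective (x∉ ∷ _) (there x∈)  (here refl) eq = contradiction (sym eq) (All.lookup (All.map⁻ x∉) x∈)
  unique-map⁻-injective (_ ∷ u)  (there x∈)  (there y∈)  eq = unique-map⁻-injective u x∈ y∈ eq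

Fin2-ext : ∀ {x y : Fin 2} → (x ≡ 1F → y ≡ 1F) → (y ≡ 1F → x ≡ 1F) → x ≡ y
Fin2-ext {0F} {0F} _ _ = refl
Fin2-ext {0F} {1F} _ g = g refl
Fin2-ext {1F} {0F} f _ = sym (f refl)
Fin2-ext {1F} {1F} _ _ = refl

module _ {n : ℕ} where

  state⇒perm : ∀ {w : List (Letter n)} → State 0 w → map abs w ↭ allFin n
  state⇒perm {w} S = ∼bag⇒↭ (unique∧set⇒bag (unique-map⁺ abs-inj unique) (Unique.allFin⁺ n)
    (mk⇔ (λ _ → Mem.∈-allFin _) (λ _ → onto _)))
    where
    open State S
    onto : ∀ i → i ∈ map abs w
    onto i with complete i z≤n
    ... | x , x∈ , refl = Mem.∈-map⁺ abs x∈

  perm⇒state : ∀ {w : List (Letter n)} → map abs w ↭ allFin n → State 0 w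
  perm⇒state {w} p = record
    { unique   = Unique.map⁻ u
    ; abs-inj  = unique-map⁻-injective u
    ; rising   = Linked.map (λ _ ()) (Linked.AllPairs⇒Linked (Unique.map⁻ {f = abs} u))
    ; complete = λ i _ → case Mem.∈-map⁻ abs (∈-resp-↭ (↭-sym p) (Mem.∈-allFin i)) of
                   λ { (x , x∈ , eq) → x , x∈ , sym eq }
    }
    where
    u : Unique (map abs w)
    u = unique-resp-↭ (↭-sym p) (Unique.allFin⁺ n)

  traced⇒realizes : ∀ (T : PT n) {w d} → Traced T w d → Realizes w d (PT.filling T)
  traced⇒realizes T {w} {d} τ = record
    { column⁻ = λ c∈ → map₂ proj₁ (marker c∈)
    ; column⁺ = λ eq → proj₁ (proj₂ (proj₁ (proj₁ (marked eq))))
    ; one⁻    = λ one → witness one (marker (proj₁ (proj₂ (proj₁ one))))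
    ; one⁺    = λ { cl (r₀ , eq , r∈ , r⊀r₀) →
                  alive⇒one T cl (marked eq) (Stage.alive⁻ (stage (Fin.toℕ<n _)) r∈) r⊀r₀ }
    }
    where
    open PT T
    open Traced τ

    marked : ∀ {c r} → d c ≡ just r → Top filling r c
    marked {c} eq with top t ← subst (Column filling c) eq (column c) = t

    marker : ∀ {c} → c ∈ₛ columns → ∃[ r ] d c ≡ just r × Top filling r c
    marker {c} c∈ with d c | column c
    ... | _ | none c∉ = contradiction c∈ c∉
    ... | _ | top t   = _ , refl , t

    witness : ∀ {r c} → One filling r c → (∃[ r₀ ] d c ≡ just r₀ × Top filling r₀ c) → OneAt w d r c
    witness {r} {c} one (r₀ , eq , t) =
      r₀ , eq , Stage.alive⁺ (stage (Fin.toℕ<n c)) (one⇒alive T one) , λ r≺r₀ → proj₂ t (r , r≺r₀ , one)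

  realizes-resp : ∀ {w w′ d d′} {F : Filling n} → (∀ c → d c ≡ d′ c × w (suc (toℕ c)) ≡ w′ (suc (toℕ c))) →
                  Realizes w d F → Realizes w′ d′ F
  realizes-resp agree R = record
    { column⁻ = λ {c} c∈ → case column⁻ c∈ of λ { (r , eq) → r , trans (sym (proj₁ (agree c))) eq }
    ; column⁺ = λ {c} eq → column⁺ (trans (proj₁ (agree c)) eq)
    ; one⁻    = λ {r} {c} one → case one⁻ one of λ { (r₀ , eq , r∈ , r⊀) →
                  r₀ , trans (sym (proj₁ (agree c))) eq , subst (r ∈_) (proj₂ (agree c)) r∈ , r⊀ }
    ; one⁺    = λ { {r} {c} cl (r₀ , eq , r∈ , r⊀) → one⁺ cl
                  (r₀ , trans (proj₁ (agree c)) eq , subst (r ∈_) (sym (proj₂ (agree c))) r∈ , r⊀) }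
    }
    where open Realizes R

  realizes⇒≈ : ∀ {w d} (T U : PT n) → Realizes w d (PT.filling T) → Realizes w d (PT.filling U) → T ≈ U
  realizes⇒≈ T U R S = columns≡ , entries
    where
    module R = Realizes R
    module S = Realizes S

    columns≡ : PT.columns T ≡ PT.columns U
    columns≡ = Subset.⊆-antisym (λ c∈ → S.column⁺ (proj₂ (R.column⁻ c∈)))
                                (λ c∈ → R.column⁺ (proj₂ (S.column⁻ c∈)))

    entries : ∀ r c → Cell (PT.columns T) r c → PT.entry T r c ≡ PT.entry U r c
    entries r c cl = Fin2-ext
      (λ eq → proj₂ (S.one⁺ (subst (λ C → Cell C r c) columns≡ cl) (R.one⁻ (cl , eq))))
      (λ eq → proj₂ (R.one⁺ cl (S.one⁻ (subst (λ C → Cell C r c) columns≡ cl , eq))))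

  ≈-realizes : ∀ {w d} (T U : PT n) → T ≈ U → Realizes w d (PT.filling T) → Realizes w d (PT.filling U)
  ≈-realizes T U (C≡ , e≡) R = record
    { column⁻ = column⁻ ∘ subst (_ ∈ₛ_) (sym C≡)
    ; column⁺ = subst (_ ∈ₛ_) C≡ ∘ column⁺
    ; one⁻    = λ (cl , eq) → one⁻ (back cl , trans (e≡ _ _ (back cl)) eq)
    ; one⁺    = λ cl o → cl , trans (sym (e≡ _ _ (back cl))) (proj₂ (one⁺ (back cl) o))
    }
    where
    open Realizes R
    back : ∀ {r c} → Cell (PT.columns U) r c → Cell (PT.columns T) r c
    back {r} {c} = subst (λ C → Cell C r c) (sym C≡)

  run⇒Φ : ∀ {w d} → Run w d → (T : PT n) → Realizes w d (PT.filling T) → Φ T ≡ just (w 0)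
  run⇒Φ ρ T R = trace⇒fold (PT.filling T) (realized-trace ρ R)

  module _ {w : ℕ → List (Letter n)} {d : Fin n → Maybe (Letter n)} (ρ : Run w d) where
    open DecMembership (_≟_ {n}) using () renaming (_∈?_ to _∈ₗ?_)

    private
      oneAt? : ∀ r c → Dec (OneAt w d r c)
      oneAt? r c with d c
      ... | nothing = no λ { (_ , () , _) }
      ... | just r₀ with r ∈ₗ? w (suc (toℕ c)) | r ≺? r₀
      ...   | yes r∈ | no r⊀  = yes (r₀ , refl , r∈ , r⊀)
      ...   | no r∉  | _      = no λ (_ , _ , r∈ , _) → r∉ r∈
      ...   | yes _  | yes r≺ = no λ { (_ , refl , _ , r⊀) → r⊀ r≺ }

      value : {P : Set} → Dec P → Fin 2
      value p? = if does p? then 1F else 0F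

      filling : Filling n
      filling = record
        { columns = Vec.tabulate (is-just ∘ d)
        ; entry   = λ r c → value (oneAt? r c)
        }

      realizes : Realizes w d filling
      realizes = record
        { column⁻ = λ {c} c∈ → is-just⁻ (trans (sym (Vec.lookup∘tabulate (is-just ∘ d) c)) (Vec.[]=⇒lookup c∈))
        ; column⁺ = λ {c} eq → Vec.lookup⇒[]= c _ (trans (Vec.lookup∘tabulate (is-just ∘ d) c) (cong is-just eq))
        ; one⁻    = λ {r} {c} (_ , eq) → entry⁻ (oneAt? r c) eq
        ; one⁺    = λ {r} {c} cl o → cl , entry⁺ (oneAt? r c) o
        }
        where
        is-just⁻ : ∀ {A : Set} {m : Maybe A} → is-just m ≡ true → ∃[ x ] m ≡ just x
        is-just⁻ {m = just x} _ = x , refl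

        entry⁻ : ∀ {P : Set} (p? : Dec P) → value p? ≡ 1F → P
        entry⁻ (yes p) _ = p

        entry⁺ : ∀ {P : Set} (p? : Dec P) → P → value p? ≡ 1F
        entry⁺ (yes _) _ = refl
        entry⁺ (no ¬p) p = contradiction p ¬p

    run⇒tableau : ∃[ T ] Realizes w d (PT.filling T)
    run⇒tableau = record
      { filling        = filling
      ; column-has-one = realized-column ρ realizes
      ; zero-condition = λ _ _ zero′ (above , left) → restricted⇒¬oneLeft ρ realizes (zero′ , inj₁ above) left
      ; diag-condition = λ _ zero′ → restricted⇒¬oneLeft ρ realizes (zero′ , inj₂ refl)
      } , realizes

  Reversed : Fin n → Rel (List (Letter n)) 0ℓ
  Reversed c v w = ∃[ d ] Move c d v w

  backwardRun : ∀ {σ} → State 0 σ → ∃₂ λ w d → w 0 ≡ σ × Run w d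
  backwardRun S with ascend n {State} {Reversed}
    (λ c S → case reverse-move S of λ { (d , v , m , S′) → v , S′ , d , m }) S
  ... | w , start , states , moves = w , proj₁ ∘ moves , start , record { state = states ; move = proj₂ ∘ moves }

  module _ (T : PT n) where

    stages : ℕ → List (Letter n)
    stages = proj₁ (traced T)

    markers : Fin n → Maybe (Letter n)
    markers = proj₁ (proj₂ (traced T))

    forwardRun : Run stages markers
    forwardRun = Traced.run (proj₂ (proj₂ (traced T)))

    stages-realized : Realizes stages markers (PT.filling T)
    stages-realized = traced⇒realizes T (proj₂ (proj₂ (traced T)))

    Φ-just : Φ T ≡ just (stages 0)
    Φ-just = run⇒Φ forwardRun T stages-realized

    Φ-perm : B n
    Φ-perm = record { word = stages 0 ; isPerm = state⇒perm (Run.state forwardRun z≤n) }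

  Φ-cong : ∀ {T U : PT n} → T ≈ U → stages T 0 ≡ stages U 0
  Φ-cong {T} {U} T≈U = just-injective
    (trans (sym (run⇒Φ (forwardRun T) U (≈-realizes T U T≈U (stages-realized T)))) (Φ-just U))

  Φ-injective : ∀ {T U : PT n} → stages T 0 ≡ stages U 0 → T ≈ U
  Φ-injective {T} {U} eq = realizes⇒≈ T U (realizes-resp agree (stages-realized T)) (stages-realized U)
    where
    agree : ∀ c → markers T c ≡ markers U c × stages T (suc (toℕ c)) ≡ stages U (suc (toℕ c))
    agree c = runs-agree-at (forwardRun T) (forwardRun U) c
      (runs-agree (forwardRun T) (forwardRun U) eq (ℕ.<⇒≤ (Fin.toℕ<n c)))

  Φ-surjective : (σ : B n) → ∃[ T ] stages T 0 ≡ B.word σ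
  Φ-surjective σ with backwardRun (perm⇒state (B.isPerm σ))
  ... | w , d , start , ρ with run⇒tableau ρ
  ...   | T , R = T , trans (just-injective (trans (sym (Φ-just T)) (run⇒Φ ρ T R))) start

proposition4p1 : (n : ℕ) → n ≥ 1 →
    Σ[ Φᴮ ∈ Bijection (PT-setoid n) (B-setoid n) ]
    ((T : PT n) → Φ T ≡ just (B.word (Bijection.to Φᴮ T)))
proposition4p1 n _ = record
  { to        = Φ-perm
  ; cong      = λ {T} {U} → Φ-cong {T = T} {U}
  ; bijective = (λ {T} {U} → Φ-injective {T = T} {U}) ,
      λ σ → proj₁ (Φ-surjective σ) , λ {U} U≈T →
        trans (Φ-cong {T = U} {proj₁ (Φ-surjective σ)} U≈T) (proj₂ (Φ-surjective σ))
  } , Φ-just
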